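{- Let $\alpha,c\in[0,1]$ satisfy $\alpha+c\ge 1$. Then the following hold. (1) Every $n$-vertex triangle-free graph with $cn^2$ edges contains a vertex set of size $\lfloor \alpha n\rfloor$ that spans at most $(2\alpha-1)cn^2$ edges. (2) Assume that $\alpha n\in\mathbb{N}$ and that $G$ is an $n$-vertex triangle-free graph with $cn^2$ edges. If every vertex set of size $\alpha n$ in $G$ spans at least $(2\alpha-1)cn^2$ edges, then $G$ is regular, and vice versa: if $G$ is regular, then every vertex set of size $\alpha n$ in $G$ spans at least $(2\alpha-1)cn^2$ edges.
   Context: All graphs are finite and simple. A vertex set $S$ of a graph $G$ spans $m$ edges if the induced subgraph $G[S]$ has exactly $m$ edges. A graph is triangle-free if it does not contain $K_3$ as a subgraph, and regular if all its vertices have the same degree.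
   Formalization: In (2), the implication "every set of size αn spans at least (2α−1)cn² edges ⇒ G is regular" is stated only for α < 1; at α = 1 it is false, e.g. for the path on 3 vertices with c = 2/9. -}

module Defs where

open import Data.Fin.Base as Fin using (Fin)
open import Data.Fin.Properties using (_<?_)
open import Data.Fin.Subset using (Subset; _∈_; ⊤)
open import Data.Fin.Subset.Properties using (_∈?_)
open import Data.Integer.Base as ℤ using (+_)
open import Data.List.Base using (length; filter; allFin; cartesianProduct)
open import Data.Nat.Base as ℕ using (ℕ; suc)
import Data.Nat.Properties as ℕₚ
open import Data.Product using (∃-syntax; _×_; _,_)
open import Data.Rational.Base as ℚ using (ℚ; 0ℚ; 1ℚ)
import Data.Rational.Properties as ℚₚ
open import Data.Rational.Solver using (module +-*-Solver)
open import Level using (0ℓ)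
open import Relation.Binary.Core using (Rel)
open import Relation.Binary.Definitions using (Decidable; Irreflexive; Symmetric)
open import Relation.Binary.PropositionalEquality
  using (_≡_; refl; sym; trans; cong; subst)
open import Relation.Nullary using (¬_; Dec)
open import Relation.Nullary.Decidable using (_×-dec_)

-- The library has no real numbers; they are taken to be Cauchy sequences of
-- rationals.

IsCauchy : (ℕ → ℚ) → Set
IsCauchy x = ∀ ε → 0ℚ ℚ.< ε →
  ∃[ N ] (∀ m n → N ℕ.≤ m → N ℕ.≤ n → ℚ.∣ x m ℚ.- x n ∣ ℚ.≤ ε)

record ℝ : Set where
  constructor mkℝ
  field
    seq    : ℕ → ℚ
    cauchy : IsCauchy seq

open ℝ public

infix 4 _≃_ _≤_ _<_

-- Equality of reals is the equivalence of Cauchy sequences, not _≡_.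

_≃_ : Rel ℝ 0ℓ
x ≃ y = ∀ ε → 0ℚ ℚ.< ε →
  ∃[ N ] (∀ n → N ℕ.≤ n → ℚ.∣ seq x n ℚ.- seq y n ∣ ℚ.≤ ε)

_≤_ : Rel ℝ 0ℓ
x ≤ y = ∀ ε → 0ℚ ℚ.< ε →
  ∃[ N ] (∀ n → N ℕ.≤ n → seq x n ℚ.≤ seq y n ℚ.+ ε)

_<_ : Rel ℝ 0ℓ
x < y = ∃[ ε ] (0ℚ ℚ.< ε ×
  ∃[ N ] (∀ n → N ℕ.≤ n → seq x n ℚ.+ ε ℚ.≤ seq y n))

private
  open +-*-Solver

  cancel-middle : ∀ a b → a ≡ (a ℚ.- b) ℚ.+ b
  cancel-middle = solve 2 (λ a b → a := (a :- b) :+ b) refl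

  difference-of-sums : ∀ a b c d →
    (a ℚ.+ b) ℚ.- (c ℚ.+ d) ≡ (a ℚ.- c) ℚ.+ (b ℚ.- d)
  difference-of-sums = solve 4 (λ a b c d →
    (a :+ b) :- (c :+ d) := (a :- c) :+ (b :- d)) refl

  difference-of-products : ∀ a b c d →
    a ℚ.* b ℚ.- c ℚ.* d ≡ a ℚ.* (b ℚ.- d) ℚ.+ (a ℚ.- c) ℚ.* d
  difference-of-products = solve 4 (λ a b c d →
    a :* b :- c :* d := a :* (b :- d) :+ (a :- c) :* d) refl

  collect : ∀ b d i e →
    b ℚ.* (i ℚ.* e) ℚ.+ (i ℚ.* e) ℚ.* d ≡ (i ℚ.* (b ℚ.+ d)) ℚ.* e
  collect = solve 4 (λ b d i e →
    b :* (i :* e) :+ (i :* e) :* d := (i :* (b :+ d)) :* e) refl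

  halve : ∀ ε → 0ℚ ℚ.< ε → ∃[ η ] (0ℚ ℚ.< η × η ℚ.+ η ≡ ε)
  halve ε 0<ε =
    ℚ.½ ℚ.* ε ,
    ℚₚ.positive⁻¹ (ℚ.½ ℚ.* ε) {{ℚₚ.pos*pos⇒pos ℚ.½ ε {{ℚ.positive 0<ε}}}} ,
    trans (sym (ℚₚ.*-distribʳ-+ ε ℚ.½ ℚ.½)) (ℚₚ.*-identityˡ ε)

  split : ∀ B D ε → 0ℚ ℚ.< B → 0ℚ ℚ.< D → 0ℚ ℚ.< ε →
    ∃[ δ ] (0ℚ ℚ.< δ × B ℚ.* δ ℚ.+ δ ℚ.* D ≡ ε)
  split B D ε 0<B 0<D 0<ε =
    go (B ℚ.+ D) refl {{ℚ.positive (ℚₚ.+-mono-< 0<B 0<D)}}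
    where
    go : ∀ C → B ℚ.+ D ≡ C → {{ℚ.Positive C}} →
         ∃[ δ ] (0ℚ ℚ.< δ × B ℚ.* δ ℚ.+ δ ℚ.* D ≡ ε)
    go C B+D≡C =
      C⁻¹ ℚ.* ε ,
      ℚₚ.positive⁻¹ (C⁻¹ ℚ.* ε)
        {{ℚₚ.pos*pos⇒pos C⁻¹ {{ℚₚ.1/pos⇒pos C}} ε {{ℚ.positive 0<ε}}}} ,
      trans (collect B D C⁻¹ ε)
        (trans (cong (λ t → (C⁻¹ ℚ.* t) ℚ.* ε) B+D≡C)
          (trans (cong (ℚ._* ε) (ℚₚ.*-inverseˡ C {{ℚₚ.pos⇒nonZero C}}))
            (ℚₚ.*-identityˡ ε)))
      where
      C⁻¹ : ℚ
      C⁻¹ = (ℚ.1/ C) {{ℚₚ.pos⇒nonZero C}}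

  -- An upper bound for the absolute values of all but finitely many terms.
  bound : ∀ x → IsCauchy x →
    ∃[ B ] (0ℚ ℚ.< B × ∃[ N ] (∀ n → N ℕ.≤ n → ℚ.∣ x n ∣ ℚ.≤ B))
  bound x cx with N , h ← cx 1ℚ (ℚₚ.positive⁻¹ 1ℚ) =
    1ℚ ℚ.+ ℚ.∣ x N ∣ ,
    ℚₚ.+-mono-<-≤ (ℚₚ.positive⁻¹ 1ℚ) (ℚₚ.0≤∣p∣ (x N)) ,
    N , λ n N≤n → begin
      ℚ.∣ x n ∣
        ≡⟨ cong ℚ.∣_∣ (cancel-middle (x n) (x N)) ⟩
      ℚ.∣ (x n ℚ.- x N) ℚ.+ x N ∣
        ≤⟨ ℚₚ.∣p+q∣≤∣p∣+∣q∣ (x n ℚ.- x N) (x N) ⟩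
      ℚ.∣ x n ℚ.- x N ∣ ℚ.+ ℚ.∣ x N ∣
        ≤⟨ ℚₚ.+-monoˡ-≤ ℚ.∣ x N ∣ (h n N N≤n ℕₚ.≤-refl) ⟩
      1ℚ ℚ.+ ℚ.∣ x N ∣ ∎
    where open ℚₚ.≤-Reasoning

  *-mono-≤-∣∣ : ∀ p q {b d} → ℚ.∣ p ∣ ℚ.≤ b → ℚ.∣ q ∣ ℚ.≤ d →
    ℚ.∣ p ℚ.* q ∣ ℚ.≤ b ℚ.* d
  *-mono-≤-∣∣ p q {b} {d} p≤b q≤d = begin
    ℚ.∣ p ℚ.* q ∣
      ≡⟨ ℚₚ.∣p*q∣≡∣p∣*∣q∣ p q ⟩
    ℚ.∣ p ∣ ℚ.* ℚ.∣ q ∣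
      ≤⟨ ℚₚ.*-monoʳ-≤-nonNeg ℚ.∣ q ∣ {{ℚ.nonNegative (ℚₚ.0≤∣p∣ q)}} p≤b ⟩
    b ℚ.* ℚ.∣ q ∣
      ≤⟨ ℚₚ.*-monoˡ-≤-nonNeg b
           {{ℚ.nonNegative (ℚₚ.≤-trans (ℚₚ.0≤∣p∣ p) p≤b)}} q≤d ⟩
    b ℚ.* d ∎
    where open ℚₚ.≤-Reasoning

  +-cauchy : ∀ x y → IsCauchy x → IsCauchy y → IsCauchy (λ n → x n ℚ.+ y n)
  +-cauchy x y cx cy ε 0<ε
    with η , 0<η , η+η≡ε ← halve ε 0<ε
    with M , f ← cx η 0<η | N , g ← cy η 0<η =
    M ℕ.⊔ N , λ m n p q → begin
      ℚ.∣ (x m ℚ.+ y m) ℚ.- (x n ℚ.+ y n) ∣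
        ≡⟨ cong ℚ.∣_∣ (difference-of-sums (x m) (y m) (x n) (y n)) ⟩
      ℚ.∣ (x m ℚ.- x n) ℚ.+ (y m ℚ.- y n) ∣
        ≤⟨ ℚₚ.∣p+q∣≤∣p∣+∣q∣ (x m ℚ.- x n) (y m ℚ.- y n) ⟩
      ℚ.∣ x m ℚ.- x n ∣ ℚ.+ ℚ.∣ y m ℚ.- y n ∣
        ≤⟨ ℚₚ.+-mono-≤
             (f m n (ℕₚ.m⊔n≤o⇒m≤o M N p) (ℕₚ.m⊔n≤o⇒m≤o M N q))
             (g m n (ℕₚ.m⊔n≤o⇒n≤o M N p) (ℕₚ.m⊔n≤o⇒n≤o M N q)) ⟩
      η ℚ.+ η
        ≡⟨ η+η≡ε ⟩
      ε ∎
    where open ℚₚ.≤-Reasoning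

  neg-cauchy : ∀ x → IsCauchy x → IsCauchy (λ n → ℚ.- x n)
  neg-cauchy x cx ε 0<ε with N , f ← cx ε 0<ε =
    N , λ m n p q → subst (ℚ._≤ ε)
      (trans (sym (ℚₚ.∣-p∣≡∣p∣ (x m ℚ.- x n)))
             (cong ℚ.∣_∣ (ℚₚ.neg-distrib-+ (x m) (ℚ.- x n))))
      (f m n p q)

  products-close : ∀ a b c d {B D δ} →
    ℚ.∣ a ∣ ℚ.≤ B → ℚ.∣ b ℚ.- d ∣ ℚ.≤ δ →
    ℚ.∣ a ℚ.- c ∣ ℚ.≤ δ → ℚ.∣ d ∣ ℚ.≤ D →
    ℚ.∣ a ℚ.* b ℚ.- c ℚ.* d ∣ ℚ.≤ B ℚ.* δ ℚ.+ δ ℚ.* D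
  products-close a b c d {B} {D} {δ} a≤B b-d≤δ a-c≤δ d≤D =
    subst (λ t → ℚ.∣ t ∣ ℚ.≤ B ℚ.* δ ℚ.+ δ ℚ.* D)
      (sym (difference-of-products a b c d))
      (ℚₚ.≤-trans
        (ℚₚ.∣p+q∣≤∣p∣+∣q∣ (a ℚ.* (b ℚ.- d)) ((a ℚ.- c) ℚ.* d))
        (ℚₚ.+-mono-≤
          (*-mono-≤-∣∣ a (b ℚ.- d) a≤B b-d≤δ)
          (*-mono-≤-∣∣ (a ℚ.- c) d a-c≤δ d≤D)))

  *-cauchy : ∀ x y → IsCauchy x → IsCauchy y → IsCauchy (λ n → x n ℚ.* y n)
  *-cauchy x y cx cy ε 0<ε =
    let
      B , 0<B , K , hB = bound x cx
      D , 0<D , L , hD = bound y cy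
      δ , 0<δ , Bδ+δD≡ε = split B D ε 0<B 0<D 0<ε
      M , f = cx δ 0<δ
      N , g = cy δ 0<δ
    in
    (K ℕ.⊔ L) ℕ.⊔ (M ℕ.⊔ N) , λ m n p q →
      let
        p₁ = ℕₚ.m⊔n≤o⇒m≤o (K ℕ.⊔ L) (M ℕ.⊔ N) p
        p₂ = ℕₚ.m⊔n≤o⇒n≤o (K ℕ.⊔ L) (M ℕ.⊔ N) p
        q₁ = ℕₚ.m⊔n≤o⇒m≤o (K ℕ.⊔ L) (M ℕ.⊔ N) q
        q₂ = ℕₚ.m⊔n≤o⇒n≤o (K ℕ.⊔ L) (M ℕ.⊔ N) q
      in
      subst (λ t → ℚ.∣ x m ℚ.* y m ℚ.- x n ℚ.* y n ∣ ℚ.≤ t) Bδ+δD≡ε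
        (products-close (x m) (y m) (x n) (y n)
          (hB m (ℕₚ.m⊔n≤o⇒m≤o K L p₁))
          (g m n (ℕₚ.m⊔n≤o⇒n≤o M N p₂) (ℕₚ.m⊔n≤o⇒n≤o M N q₂))
          (f m n (ℕₚ.m⊔n≤o⇒m≤o M N p₂) (ℕₚ.m⊔n≤o⇒m≤o M N q₂))
          (hD n (ℕₚ.m⊔n≤o⇒n≤o K L q₁)))

infixl 6 _+_ _-_
infixl 7 _*_
infix  8 -_

_+_ : ℝ → ℝ → ℝ
x + y = mkℝ (λ n → seq x n ℚ.+ seq y n) (+-cauchy (seq x) (seq y) (cauchy x) (cauchy y))

-_ : ℝ → ℝ
- x = mkℝ (λ n → ℚ.- seq x n) (neg-cauchy (seq x) (cauchy x))

_-_ : ℝ → ℝ → ℝ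
x - y = x + - y

_*_ : ℝ → ℝ → ℝ
x * y = mkℝ (λ n → seq x n ℚ.* seq y n) (*-cauchy (seq x) (seq y) (cauchy x) (cauchy y))

fromℚ : ℚ → ℝ
fromℚ q = mkℝ (λ _ → q) λ ε 0<ε → 0 , λ _ _ _ _ →
  subst (ℚ._≤ ε) (sym (cong ℚ.∣_∣ (ℚₚ.+-inverseʳ q))) (ℚₚ.<⇒≤ 0<ε)

fromℕ : ℕ → ℝ
fromℕ n = fromℚ (+ n ℚ./ 1)

0ℝ 1ℝ 2ℝ : ℝ
0ℝ = fromℕ 0
1ℝ = fromℕ 1
2ℝ = fromℕ 2

-- The floor is not computable on reals, so ⌊ x ⌋ = k is a relation.

⌊_⌋≡_ : ℝ → ℕ → Set
⌊ x ⌋≡ k = (fromℕ k ≤ x) × (x < fromℕ (suc k))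

record Graph (n : ℕ) : Set₁ where
  field
    _~_      : Rel (Fin n) 0ℓ
    _~?_     : Decidable _~_
    ~-sym    : Symmetric _~_
    ~-irrefl : Irreflexive _≡_ _~_

module _ {n : ℕ} (G : Graph n) where
  open Graph G

  -- The edges of G[S]; each is counted once, as the pair u < v of its ends.

  EdgeWithin : Subset n → Fin n × Fin n → Set
  EdgeWithin S (u , v) = u Fin.< v × u ∈ S × v ∈ S × u ~ v

  edgeWithin? : ∀ S e → Dec (EdgeWithin S e)
  edgeWithin? S (u , v) = (u <? v) ×-dec (u ∈? S) ×-dec (v ∈? S) ×-dec (u ~? v)

  edgesSpanned : Subset n → ℕ
  edgesSpanned S =
    length (filter (edgeWithin? S) (cartesianProduct (allFin n) (allFin n)))

  edgeCount : ℕ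
  edgeCount = edgesSpanned ⊤

  degree : Fin n → ℕ
  degree v = length (filter (v ~?_) (allFin n))

  TriangleFree : Set
  TriangleFree = ∀ u v w → u ~ v → v ~ w → ¬ (u ~ w)

  Regular : Set
  Regular = ∀ u v → degree u ≡ degree v

{-# OPTIONS --safe #-}

-- Write m = n - k, and for the complement T of a k-set S compare the number of
-- edges meeting T with m d̄, where d̄ = 2e/n is the average degree; the condition
-- α + c ≥ 1 says m ≤ d̄/2, up to rounding.  Suppose that no m-set meets more than
-- m d̄ edges.  Neighbourhoods are independent sets, so in a neighbourhood the edges
-- met are counted by degrees.  If d(v) ≥ m, the m vertices of largest degree in
-- N(v) show that N(v) has average degree at most d̄; if d(v) < m, extend N(v) to an
-- m-set, each new vertex meeting a new edge.  Together, with D(v) the sum of the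
-- degrees in N(v), these give D(v) ≤ d(v)² + d̄² - d̄ d(v), strictly if d(v) < m and
-- otherwise with equality only if d(v) = d̄.  Since Σ D(v) = Σ d(v)², both sides have
-- the same sum over v, so equality holds throughout and G is regular.
-- Conversely, in a regular graph an m-set meets at most m d̄ edges, with equality
-- for an m-set inside a neighbourhood.
module Submission where

open import Data.Fin.Base using (Fin; zero; suc; fromℕ<)
import Data.Fin.Properties as Fin
open import Data.Fin.Subset using (Subset; ∣_∣)
import Data.Integer.Base as ℤ
import Data.Integer.Properties as ℤₚ
open import Data.Nat.Base as ℕ using (ℕ; zero; suc)
open import Data.Nat.Coprimality as Coprime using (1-coprimeTo)
import Data.Nat.Properties as ℕₚ
open import Data.Nat.Tactic.RingSolver using (solve-∀)
open import Data.Product using (_×_; _,_; ∃-syntax)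
open import Data.Rational.Base as ℚ using (ℚ; 0ℚ; 1ℚ; mkℚ)
import Data.Rational.Properties as ℚₚ
open import Data.Rational.Solver using (module +-*-Solver)
open import Data.Sum.Base using (inj₁; inj₂)
open import Data.Vec.Base using ([])
open import Function.Base using (_∘_)
import Relation.Binary.Reasoning.Base.Single as SingleReasoning
open import Relation.Binary.PropositionalEquality
  using (_≡_; refl; sym; trans; cong; cong₂; subst; subst₂; module ≡-Reasoning)
open import Relation.Nullary using (¬_; Dec; does; yes; no; contradiction)

module Combinatorics where

  open import Algebra.Properties.Semiring.Sum ℕₚ.+-*-semiring
    using (sum; sum-syntax; sum-cong-≗; ∑-distrib-+; ∑-comm; *-distribˡ-sum; *-distribʳ-sum)
  open import Data.Bool.Base using (Bool; true; false; not; _∧_)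
  open import Data.Bool.Properties using (not-involutive)
  open import Data.Fin.Subset using (inside; outside; _∈_; _⊆_; ∁; ⊤)
  import Data.Fin.Subset.Properties as Sub
  open import Data.List.Base as List using (length; filter; cartesianProduct)
  import Data.List.Properties as List
  open import Data.Nat.Base
  open import Data.Nat.Properties
  open import Data.Vec.Base using (lookup; tabulate; _[_]≔_; _∷_; here; there)
  import Data.Vec.Properties as Vec
  open import Defs using (Graph; edgesSpanned; edgeWithin?; degree; TriangleFree; Regular)
  open import Relation.Binary.Definitions using (tri<; tri≈; tri>)
  open import Relation.Nullary.Decidable using (_×-dec_; dec-true; dec-false)
  open import Relation.Unary using (Decidable)

  private variable
    n : ℕ

  -- Sums of naturals over `Fin n` and over subsets.

  bit : Bool → ℕ
  bit true  = 1
  bit false = 0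

  bit-∧ : ∀ a b → bit (a ∧ b) ≡ bit a * bit b
  bit-∧ true  b = sym (+-identityʳ (bit b))
  bit-∧ false b = refl

  sum-mono-≤ : {f g : Fin n → ℕ} → (∀ i → f i ≤ g i) → sum f ≤ sum g
  sum-mono-≤ {zero}  f≤g = z≤n
  sum-mono-≤ {suc n} f≤g = +-mono-≤ (f≤g zero) (sum-mono-≤ (f≤g ∘ suc))

  -- A loss in a single term could not be made up by the other terms. This turns equality of the two
  -- sums over all vertices into equality at each vertex.
  sum-mono-≤-tight : {f g : Fin n → ℕ} → (∀ i → f i ≤ g i) → sum g ≤ sum f → ∀ i → g i ≤ f i
  sum-mono-≤-tight {suc n} {f} {g} f≤g Σg≤Σf zero =
    +-cancelʳ-≤ (sum (g ∘ suc)) (g zero) (f zero)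
      (≤-trans Σg≤Σf (+-monoʳ-≤ (f zero) (sum-mono-≤ (f≤g ∘ suc))))
  sum-mono-≤-tight {suc n} {f} {g} f≤g Σg≤Σf (suc i) =
    sum-mono-≤-tight (f≤g ∘ suc)
      (+-cancelˡ-≤ (g zero) _ _ (≤-trans Σg≤Σf (+-monoˡ-≤ (sum (f ∘ suc)) (f≤g zero)))) i

  sum-<⇒∃< : (f g : Fin n → ℕ) → sum f < sum g → ∃[ i ] (f i < g i)
  sum-<⇒∃< f g Σf<Σg with Fin.any? (λ i → f i <? g i)
  ... | yes ∃i = ∃i
  ... | no ∄i = contradiction (sum-mono-≤ (λ i → ≮⇒≥ (λ lt → ∄i (i , lt)))) (<⇒≱ Σf<Σg)

  sum-const : ∀ n c → ∑[ i < n ] c ≡ n * c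
  sum-const zero    c = refl
  sum-const (suc n) c = cong (c +_) (sum-const n c)

  χ : Subset n → Fin n → ℕ
  χ p i = bit (lookup p i)

  ∑∈ : Subset n → (Fin n → ℕ) → ℕ
  ∑∈ {n} p f = ∑[ i < n ] (χ p i * f i)

  χ-mono-≤ : ∀ (p : Subset n) i {a b} → (i ∈ p → a ≤ b) → χ p i * a ≤ χ p i * b
  χ-mono-≤ p i a≤b with lookup p i in eq
  ... | inside  = *-monoʳ-≤ 1 (a≤b (Vec.lookup⇒[]= i p eq))
  ... | outside = z≤n

  ∑∈-mono-≤ : ∀ (p : Subset n) {f g} → (∀ i → i ∈ p → f i ≤ g i) → ∑∈ p f ≤ ∑∈ p g
  ∑∈-mono-≤ p f≤g = sum-mono-≤ (λ i → χ-mono-≤ p i (f≤g i))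

  ∑∈-cong : ∀ (p : Subset n) {f g} → (∀ i → f i ≡ g i) → ∑∈ p f ≡ ∑∈ p g
  ∑∈-cong p f≗g = sum-cong-≗ (λ i → cong (χ p i *_) (f≗g i))

  ∑∈-<⇒∃< : ∀ (p : Subset n) f g → ∑∈ p f < ∑∈ p g → ∃[ i ] (i ∈ p × f i < g i)
  ∑∈-<⇒∃< p f g lt with i , χf<χg ← sum-<⇒∃< _ _ lt with lookup p i in eq
  ... | inside = i , Vec.lookup⇒[]= i p eq ,
    subst₂ _<_ (*-identityˡ (f i)) (*-identityˡ (g i)) χf<χg

  ∑∈-distrib-+ : ∀ (p : Subset n) f g → ∑∈ p (λ i → f i + g i) ≡ ∑∈ p f + ∑∈ p g
  ∑∈-distrib-+ p f g =
    trans (sum-cong-≗ (λ i → *-distribˡ-+ (χ p i) (f i) (g i)))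
      (∑-distrib-+ (λ i → χ p i * f i) (λ i → χ p i * g i))

  private
    swap : ∀ a b c → a * (b * c) ≡ b * (a * c)
    swap = solve-∀

  *-distribˡ-∑∈ : ∀ (p : Subset n) c f → c * ∑∈ p f ≡ ∑∈ p (λ i → c * f i)
  *-distribˡ-∑∈ p c f = trans (*-distribˡ-sum c (λ i → χ p i * f i))
    (sum-cong-≗ (λ i → swap c (χ p i) (f i)))

  ∣∣≡sum-χ : ∀ (p : Subset n) → ∣ p ∣ ≡ sum (χ p)
  ∣∣≡sum-χ []            = refl
  ∣∣≡sum-χ (inside ∷ p)  = cong suc (∣∣≡sum-χ p)
  ∣∣≡sum-χ (outside ∷ p) = ∣∣≡sum-χ p

  ∑∈-const : ∀ (p : Subset n) c → ∑∈ p (λ _ → c) ≡ ∣ p ∣ * c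
  ∑∈-const p c = trans (sym (*-distribʳ-sum c (χ p))) (cong (_* c) (sym (∣∣≡sum-χ p)))

  ∑∈-∁ : ∀ (p : Subset n) f → ∑∈ p f + ∑∈ (∁ p) f ≡ sum f
  ∑∈-∁ p f = trans (sym (∑-distrib-+ (λ i → χ p i * f i) (λ i → χ (∁ p) i * f i))) (sum-cong-≗ λ i →
    trans (cong (λ b → χ p i * f i + bit b * f i) (Vec.lookup-map i not p)) (split (lookup p i) (f i)))
    where
    split : ∀ b x → bit b * x + bit (not b) * x ≡ x
    split true  x = trans (+-identityʳ (1 * x)) (*-identityˡ x)
    split false x = *-identityˡ x

  ∑∈-⊤ : ∀ (f : Fin n → ℕ) → ∑∈ ⊤ f ≡ sum f
  ∑∈-⊤ f = sum-cong-≗ λ i →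
    trans (cong (λ b → bit b * f i) (Vec.lookup-replicate i inside)) (*-identityˡ (f i))

  ∑∈-comm : ∀ (p q : Subset n) (f : Fin n → Fin n → ℕ) →
    ∑∈ p (λ i → ∑∈ q (f i)) ≡ ∑∈ q (λ j → ∑∈ p (λ i → f i j))
  ∑∈-comm {n} p q f = begin
    ∑∈ p (λ i → ∑∈ q (f i))
      ≡⟨ sum-cong-≗ (λ i → *-distribˡ-∑∈ q (χ p i) (f i)) ⟩
    ∑[ i < n ] ∑[ j < n ] (χ q j * (χ p i * f i j))
      ≡⟨ ∑-comm (λ i j → χ q j * (χ p i * f i j)) ⟩
    ∑[ j < n ] ∑[ i < n ] (χ q j * (χ p i * f i j))
      ≡⟨ sum-cong-≗ (λ j → *-distribˡ-sum (χ q j) (λ i → χ p i * f i j)) ⟨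
    ∑∈ q (λ j → ∑∈ p (λ i → f i j)) ∎
    where open ≡-Reasoning

  -- Removal of an element, complements and cardinalities.

  _∖_ : Subset n → Fin n → Subset n
  p ∖ x = p [ x ]≔ outside

  ∖⊆ : ∀ (p : Subset n) x → (p ∖ x) ⊆ p
  ∖⊆ (_ ∷ p) zero    (there y∈p)   = there y∈p
  ∖⊆ (_ ∷ p) (suc x) here          = here
  ∖⊆ (_ ∷ p) (suc x) (there y∈p∖x) = there (∖⊆ p x y∈p∖x)

  ∑∈-∖ : ∀ (p : Subset n) {x} → x ∈ p → ∀ f → ∑∈ (p ∖ x) f + f x ≡ ∑∈ p f
  ∑∈-∖ (_ ∷ p) {zero} here f =
    trans (+-comm (∑∈ p (f ∘ suc)) (f zero)) (cong (_+ ∑∈ p (f ∘ suc)) (sym (*-identityˡ (f zero))))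
  ∑∈-∖ (b ∷ p) {suc x} (there x∈p) f =
    trans (+-assoc (bit b * f zero) (∑∈ (p ∖ x) (f ∘ suc)) (f (suc x)))
      (cong (bit b * f zero +_) (∑∈-∖ p x∈p (f ∘ suc)))

  ∣∖∣ : ∀ (p : Subset n) {x} → x ∈ p → suc ∣ p ∖ x ∣ ≡ ∣ p ∣
  ∣∖∣ p {x} x∈p = begin
    suc ∣ p ∖ x ∣
      ≡⟨ cong suc (trans (sym (*-identityʳ _)) (sym (∑∈-const (p ∖ x) 1))) ⟩
    suc (∑∈ (p ∖ x) (λ _ → 1))  ≡⟨ +-comm 1 _ ⟩
    ∑∈ (p ∖ x) (λ _ → 1) + 1    ≡⟨ ∑∈-∖ p x∈p (λ _ → 1) ⟩
    ∑∈ p (λ _ → 1)              ≡⟨ trans (∑∈-const p 1) (*-identityʳ _) ⟩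
    ∣ p ∣ ∎
    where open ≡-Reasoning

  ∣∁∣ : ∀ (p : Subset n) → ∣ p ∣ + ∣ ∁ p ∣ ≡ n
  ∣∁∣ p = trans (cong (∣ p ∣ +_) (Sub.∣∁p∣≡n∸∣p∣ p)) (m+[n∸m]≡n (Sub.∣p∣≤n p))

  ∁∁ : ∀ (p : Subset n) → ∁ (∁ p) ≡ p
  ∁∁ p = trans (sym (Vec.map-∘ not not p)) (trans (Vec.map-cong not-involutive p) (Vec.map-id p))

  -- Averaging over subsets.

  ∃-below-average : ∀ (p : Subset n) f → 0 < ∣ p ∣ → ∃[ x ] (x ∈ p × ∣ p ∣ * f x ≤ ∑∈ p f)
  ∃-below-average p f 0<∣p∣
    -- The constant `suc (∑∈ p f)` makes the comparison of sums strict; the extra 1 is removed again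
    -- by `s≤s⁻¹`.
    with x , x∈p , lt ← ∑∈-<⇒∃< p (λ i → ∣ p ∣ * f i) (λ _ → suc (∑∈ p f))
           (subst₂ _<_ (*-distribˡ-∑∈ p ∣ p ∣ f) (sym (∑∈-const p (suc (∑∈ p f))))
             (*-monoʳ-< ∣ p ∣ {{>-nonZero 0<∣p∣}} ≤-refl))
    = x , x∈p , s≤s⁻¹ lt

  -- Deleting an element that is at most the average never lowers the average; this is done `j`
  -- times. Averages are compared cross-multiplied. The result plays the role of the `m` vertices of
  -- largest degree.
  ∃-above-average-subset : ∀ m j (p : Subset n) f → ∣ p ∣ ≡ j + m →
    ∃[ q ] (q ⊆ p × ∣ q ∣ ≡ m × m * ∑∈ p f ≤ ∣ p ∣ * ∑∈ q f)
  ∃-above-average-subset m zero p f ∣p∣≡m =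
    p , (λ x∈p → x∈p) , ∣p∣≡m , ≤-reflexive (cong (_* ∑∈ p f) (sym ∣p∣≡m))
  ∃-above-average-subset m (suc j) p f ∣p∣≡1+j+m
    with x , x∈p , ∣p∣fx≤Σ ← ∃-below-average p f (subst (0 <_) (sym ∣p∣≡1+j+m) z<s)
    with ∣p∖x∣≡j+m ← suc-injective (trans (∣∖∣ p x∈p) ∣p∣≡1+j+m)
    with q , q⊆p∖x , ∣q∣≡m , le ← ∃-above-average-subset m j (p ∖ x) f ∣p∖x∣≡j+m
    = q , ∖⊆ p x ∘ q⊆p∖x , ∣q∣≡m , goal
    where
    open ≤-Reasoning
    A = ∑∈ (p ∖ x) f
    B = ∑∈ q f

    average-∖ : (j + m) * ∑∈ p f ≤ suc (j + m) * A
    average-∖ = +-cancelˡ-≤ (∑∈ p f) _ _ (begin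
      suc (j + m) * ∑∈ p f                 ≡⟨ cong (suc (j + m) *_) (∑∈-∖ p x∈p f) ⟨
      suc (j + m) * (A + f x)              ≡⟨ *-distribˡ-+ (suc (j + m)) A (f x) ⟩
      suc (j + m) * A + suc (j + m) * f x
        ≤⟨ +-monoʳ-≤ (suc (j + m) * A) (subst (λ t → t * f x ≤ ∑∈ p f) ∣p∣≡1+j+m ∣p∣fx≤Σ) ⟩
      suc (j + m) * A + ∑∈ p f             ≡⟨ +-comm _ (∑∈ p f) ⟩
      ∑∈ p f + suc (j + m) * A             ∎)

    -- Chains the two comparisons of averages and cancels the size `t` of `p ∖ x`, which is positive
    -- unless `m` is 0.
    cancel : ∀ m t → m ≤ t → t * ∑∈ p f ≤ suc t * A → m * A ≤ t * B →
      m * ∑∈ p f ≤ suc t * B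
    cancel zero      t _   _  _  = z≤n
    cancel m@(suc _) t m≤t h₁ h₂ = *-cancelˡ-≤ t {{>-nonZero (≤-trans z<s m≤t)}} (begin
      t * (m * ∑∈ p f)  ≡⟨ swap t m (∑∈ p f) ⟩
      m * (t * ∑∈ p f)  ≤⟨ *-monoʳ-≤ m h₁ ⟩
      m * (suc t * A)   ≡⟨ swap m (suc t) A ⟩
      suc t * (m * A)   ≤⟨ *-monoʳ-≤ (suc t) h₂ ⟩
      suc t * (t * B)   ≡⟨ swap (suc t) t B ⟩
      t * (suc t * B)   ∎)

    goal : m * ∑∈ p f ≤ ∣ p ∣ * B
    goal = subst (λ t → m * ∑∈ p f ≤ t * B) (sym ∣p∣≡1+j+m)
      (cancel m (j + m) (m≤n+m m j) average-∖ (subst (λ t → m * A ≤ t * B) ∣p∖x∣≡j+m le))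

  -- Quadratic inequalities between naturals.

  square-sum : ∀ a t → a * a + (a + t) * (a + t) ≡ 2 * (a * (a + t)) + t * t
  square-sum = solve-∀

  -- With the larger number written as the smaller plus `t`, the excess is t². The equality case
  -- below reads off t = 0 in the same way.
  2ab≤a²+b² : ∀ a b → 2 * (a * b) ≤ a * a + b * b
  2ab≤a²+b² a b with ≤-total a b
  ... | inj₁ a≤b with t , refl ← m≤n⇒∃[o]m+o≡n a≤b =
    subst (2 * (a * b) ≤_) (sym (square-sum a t)) (m≤m+n _ (t * t))
  ... | inj₂ b≤a with t , refl ← m≤n⇒∃[o]m+o≡n b≤a =
    subst₂ _≤_ (cong (2 *_) (*-comm b a))
      (trans (sym (square-sum b t)) (+-comm (b * b) (a * a))) (m≤m+n _ (t * t))

  private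
    t²≤0⇒t≡0 : ∀ t {c} → c + t * t ≤ c → t ≡ 0
    t²≤0⇒t≡0 zero    _ = refl
    t²≤0⇒t≡0 (suc t) {c} h = contradiction h (<⇒≱ (m<m+n c z<s))

  a²+b²≤2ab⇒a≡b : ∀ a b → a * a + b * b ≤ 2 * (a * b) → a ≡ b
  a²+b²≤2ab⇒a≡b a b h with ≤-total a b
  ... | inj₁ a≤b with t , refl ← m≤n⇒∃[o]m+o≡n a≤b =
    sym (trans
      (cong (a +_) (t²≤0⇒t≡0 t (subst (_≤ 2 * (a * (a + t))) (square-sum a t) h)))
      (+-identityʳ a))
  ... | inj₂ b≤a with t , refl ← m≤n⇒∃[o]m+o≡n b≤a =
    trans
      (cong (b +_) (t²≤0⇒t≡0 t (subst₂ _≤_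
        (trans (+-comm (a * a) (b * b)) (square-sum b t)) (cong (2 *_) (*-comm a b)) h)))
      (+-identityʳ b)

  -- The inequality d̄ (m + d) < d² + d̄² + (m - d) for d < m and 2 (m - 1) < d̄, multiplied
  -- by n², with q = n d̄ and m = d + i + 1.  The excess is, with r = q - 2 n (m - 1),
  --   n² ((d + i - 1)² + i² + i) + n r (2 d + 3 i - 1) + r².
  low-degree-bound : ∀ n d i q → 2 * (n * (d + i)) < q →
    n * (q * suc (d + i)) + n * (q * d) < (n * d) * (n * d) + q * q + n * (n * suc i)
  low-degree-bound zero zero zero (suc q) _ = z<s
  -- For d = i = 0 the coefficient 2 d + 3 i - 1 is negative, so the expansion is replaced by n q <
  -- 2 n q ≤ n² + q².
  low-degree-bound n@(suc _) zero zero q@(suc _) _ = begin-strict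
    n * (q * 1) + n * (q * 0)                ≡⟨ lhs n q ⟩
    n * q                                    <⟨ m<m+n (n * q) (s≤s z≤n) ⟩
    n * q + n * q                            ≡⟨ double n q ⟩
    2 * (n * q)                              ≤⟨ 2ab≤a²+b² n q ⟩
    n * n + q * q                            ≡⟨ rhs n q ⟩
    (n * 0) * (n * 0) + q * q + n * (n * 1)  ∎
    where
    open ≤-Reasoning
    lhs : ∀ n q → n * (q * 1) + n * (q * 0) ≡ n * q
    lhs = solve-∀
    double : ∀ n q → n * q + n * q ≡ 2 * (n * q)
    double = solve-∀
    rhs : ∀ n q → n * n + q * q ≡ (n * 0) * (n * 0) + q * q + n * (n * 1)
    rhs = solve-∀
  low-degree-bound n zero (suc i) q lt with r , refl ← m≤n⇒∃[o]m+o≡n lt =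
    ≤-trans (m<m+n (n * (q * suc (suc i)) + n * (q * 0)) (≤-trans z<s (m≤n+m (suc r * suc r) _)))
      (≤-reflexive (sym (expand n i r)))
    where
    expand : ∀ n i r → let q = suc (2 * (n * suc i)) + r in
      (n * 0) * (n * 0) + q * q + n * (n * suc (suc i)) ≡
      (n * (q * suc (suc i)) + n * (q * 0)) +
      (n * (n * (i * i + suc i * suc i + suc i)) + n * (suc r * (3 * i + 2)) + suc r * suc r)
    expand = solve-∀
  low-degree-bound n (suc d) i q lt with r , refl ← m≤n⇒∃[o]m+o≡n lt =
    ≤-trans (m<m+n (n * (q * suc (suc d + i)) + n * (q * suc d))
      (≤-trans z<s (m≤n+m (suc r * suc r) _)))
      (≤-reflexive (sym (expand n d i r)))
    where
    expand : ∀ n d i r → let q = suc (2 * (n * (suc d + i))) + r in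
      (n * suc d) * (n * suc d) + q * q + n * (n * suc i) ≡
      (n * (q * suc (suc d + i)) + n * (q * suc d)) +
      (n * (n * ((d + i) * (d + i) + i * i + i)) + n * (suc r * (2 * d + 3 * i + 1)) + suc r * suc r)
    expand = solve-∀

  -- Lengths of filtered lists as sums of indicators.

  count-bit : ∀ {A : Set} {P : A → Set} (P? : Decidable P) (g : Fin n → A) →
    length (filter P? (List.tabulate g)) ≡ ∑[ i < n ] bit (does (P? (g i)))
  count-bit {zero}  P? g = refl
  count-bit {suc n} P? g with does (P? (g zero))
  ... | true  = cong suc (count-bit P? (g ∘ suc))
  ... | false = count-bit P? (g ∘ suc)

  count-bit-× : ∀ {m} {A B : Set} {P : A × B → Set} (P? : Decidable P) (g : Fin m → A) (h : Fin n → B) →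
    length (filter P? (cartesianProduct (List.tabulate g) (List.tabulate h))) ≡
    ∑[ i < m ] ∑[ j < n ] bit (does (P? (g i , h j)))
  count-bit-× {m = zero}  P? g h = refl
  count-bit-× {n} {m = suc m} P? g h = begin
    length (filter P? (row List.++ rest))
      ≡⟨ cong length (List.filter-++ P? row rest) ⟩
    length (filter P? row List.++ filter P? rest)
      ≡⟨ List.length-++ (filter P? row) ⟩
    length (filter P? row) + length (filter P? rest)
      ≡⟨ cong₂ _+_
           (trans (cong (length ∘ filter P?) (List.map-tabulate h (g zero ,_)))
             (count-bit P? (λ j → g zero , h j)))
           (count-bit-× P? (g ∘ suc) h) ⟩
    ∑[ i < suc m ] ∑[ j < n ] bit (does (P? (g i , h j))) ∎
    where
    open ≡-Reasoning
    row  = List.map (g zero ,_) (List.tabulate h)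
    rest = cartesianProduct (List.tabulate (g ∘ suc)) (List.tabulate h)

  does-∈? : ∀ x (p : Subset n) → does (x Sub.∈? p) ≡ lookup p x
  does-∈? zero    (inside  ∷ p) = refl
  does-∈? zero    (outside ∷ p) = refl
  does-∈? (suc x) (_ ∷ p)       = does-∈? x p

  bit-yes : ∀ {P : Set} (P? : Dec P) → P → bit (does P?) ≡ 1
  bit-yes P? p = cong bit (dec-true P? p)

  bit-no : ∀ {P : Set} (P? : Dec P) → ¬ P → bit (does P?) ≡ 0
  bit-no P? ¬p = cong bit (dec-false P? ¬p)

  -- Adjacency, degrees and edge counts.

  module Counting {n : ℕ} (G : Graph n) where
    open Graph G

    A : Fin n → Fin n → ℕ
    A u v = bit (does (u ~? v))

    N : Fin n → Subset n
    N v = tabulate (λ u → does (v ~? u))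

    χ-N : ∀ v u → χ (N v) u ≡ A v u
    χ-N v u = cong bit (Vec.lookup∘tabulate (λ u → does (v ~? u)) u)

    ∈N⇒~ : ∀ {v u} → u ∈ N v → v ~ u
    ∈N⇒~ {v} {u} u∈N with v ~? u in eq
    ... | yes v~u = v~u
    ... | no  _ = contradiction
      (trans (sym (trans (Vec.lookup∘tabulate _ u) (cong does eq))) (Vec.[]=⇒lookup u∈N)) λ ()

    A-sym : ∀ u v → A u v ≡ A v u
    A-sym u v with u ~? v
    ... | yes u~v = sym (bit-yes (v ~? u) (~-sym u~v))
    ... | no u≁v = sym (bit-no (v ~? u) (u≁v ∘ ~-sym))

    d : Fin n → ℕ
    d = degree G

    d≡∑A : ∀ v → d v ≡ sum (A v)
    d≡∑A v = count-bit (v ~?_) (λ u → u)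

    ∣N∣≡d : ∀ v → ∣ N v ∣ ≡ d v
    ∣N∣≡d v = trans (∣∣≡sum-χ (N v)) (trans (sum-cong-≗ (χ-N v)) (sym (d≡∑A v)))

    d≤n : ∀ v → d v ≤ n
    d≤n v = subst (_≤ n) (∣N∣≡d v) (Sub.∣p∣≤n (N v))

    e : Subset n → ℕ
    e = edgesSpanned G

    ordered : Fin n → Fin n → ℕ
    ordered u v = bit (does (u Fin.<? v))

    -- Exactly one of u < v and v < u holds off the diagonal, and on the diagonal `A` vanishes by
    -- irreflexivity.
    A-ordered : ∀ u v → (ordered u v + ordered v u) * A u v ≡ A u v
    A-ordered u v with Fin.<-cmp u v
    ... | tri< u<v _ v≮u = trans
      (cong (_* A u v) (cong₂ _+_ (bit-yes (u Fin.<? v) u<v) (bit-no (v Fin.<? u) v≮u)))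
      (*-identityˡ (A u v))
    ... | tri> u≮v _ v<u = trans
      (cong (_* A u v) (cong₂ _+_ (bit-no (u Fin.<? v) u≮v) (bit-yes (v Fin.<? u) v<u)))
      (*-identityˡ (A u v))
    ... | tri≈ _ refl _ rewrite bit-no (u ~? u) (~-irrefl refl) = *-zeroʳ (ordered u u + ordered u u)

    -- Counts ordered adjacent pairs, so that it is symmetric in the two ends and free of the order
    -- on `Fin n`.
    e₂ : Subset n → ℕ
    e₂ S = ∑∈ S (λ u → ∑∈ S (A u))

    -- Each ordered pair is sorted by which end is smaller; interchanging the two summations
    -- identifies the two halves.
    e₂≡2e : ∀ S → e₂ S ≡ 2 * e S
    e₂≡2e S = begin
      e₂ S
        ≡⟨ sum-cong-≗ (λ u → *-distribˡ-sum (χ S u) (λ v → χ S v * A u v)) ⟩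
      ∑[ u < n ] ∑[ v < n ] (χ S u * (χ S v * A u v))
        ≡⟨ sum-cong-≗ (λ u → sum-cong-≗ (λ v → halve u v)) ⟩
      ∑[ u < n ] ∑[ v < n ] (f u v + f v u)
        ≡⟨ sum-cong-≗ (λ u → ∑-distrib-+ (f u) (λ v → f v u)) ⟩
      ∑[ u < n ] (∑[ v < n ] f u v + ∑[ v < n ] f v u)
        ≡⟨ ∑-distrib-+ (λ u → ∑[ v < n ] f u v) (λ u → ∑[ v < n ] f v u) ⟩
      ∑[ u < n ] ∑[ v < n ] f u v + ∑[ u < n ] ∑[ v < n ] f v u
        ≡⟨ cong (∑[ u < n ] ∑[ v < n ] f u v +_)
             (trans (∑-comm (λ u v → f v u)) (sym (+-identityʳ _))) ⟩
      2 * ∑[ u < n ] ∑[ v < n ] f u v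
        ≡⟨ cong (2 *_) (count-bit-× (edgeWithin? G S) (λ u → u) (λ v → v)) ⟨
      2 * e S ∎
      where
      open ≡-Reasoning
      f : Fin n → Fin n → ℕ
      f u v = bit (does (edgeWithin? G S (u , v)))

      f≡ : ∀ u v → f u v ≡ ordered u v * (χ S u * (χ S v * A u v))
      f≡ u v rewrite does-∈? u S | does-∈? v S =
        trans (bit-∧ (does (u Fin.<? v)) _) (cong (ordered u v *_)
          (trans (bit-∧ (lookup S u) _) (cong (χ S u *_) (bit-∧ (lookup S v) _))))

      regroup : ∀ o o′ s t a → o * (s * (t * a)) + o′ * (t * (s * a)) ≡ s * (t * ((o + o′) * a))
      regroup = solve-∀

      halve : ∀ u v → χ S u * (χ S v * A u v) ≡ f u v + f v u
      halve u v = begin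
        χ S u * (χ S v * A u v)
          ≡⟨ cong (λ a → χ S u * (χ S v * a)) (A-ordered u v) ⟨
        χ S u * (χ S v * ((ordered u v + ordered v u) * A u v))
          ≡⟨ regroup (ordered u v) (ordered v u) (χ S u) (χ S v) (A u v) ⟨
        ordered u v * (χ S u * (χ S v * A u v)) + ordered v u * (χ S v * (χ S u * A u v))
          ≡⟨ cong₂ _+_ (f≡ u v) (trans (f≡ v u)
               (cong (λ a → ordered v u * (χ S v * (χ S u * a))) (A-sym v u))) ⟨
        f u v + f v u ∎

    ∑d≡2e : sum d ≡ 2 * e ⊤
    ∑d≡2e = trans
      (sym (trans (∑∈-⊤ (λ u → ∑∈ ⊤ (A u)))
        (sum-cong-≗ (λ u → trans (∑∈-⊤ (A u)) (sym (d≡∑A u))))))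
      (e₂≡2e ⊤)

    -- The degree sum over `T` counts the edges meeting `T`, but those inside `T` twice, whence the
    -- term `e T`. The proof doubles everything and splits ordered pairs by the sides of their ends.
    edges-∁ : ∀ T → e (∁ T) + ∑∈ T d ≡ e ⊤ + e T
    edges-∁ T = *-cancelˡ-≡ _ _ 2 (begin
      2 * (e S + ∑∈ T d)
        ≡⟨ *-distribˡ-+ 2 (e S) (∑∈ T d) ⟩
      2 * e S + 2 * ∑∈ T d
        ≡⟨ cong₂ (λ a b → a + 2 * b) (sym (e₂≡2e S)) (degrees T) ⟩
      B S S + 2 * (B T T + B T S)
        ≡⟨ regroup (B S S) (B T T) (B T S) ⟩
      (B T T + B T S + (B T S + B S S)) + B T T
        ≡⟨ cong (λ t → B T T + B T S + (t + B S S) + B T T) B-comm ⟩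
      (B T T + B T S + (B S T + B S S)) + B T T
        ≡⟨ cong₂ (λ a b → a + b + B T T) (degrees T) (degrees S) ⟨
      (∑∈ T d + ∑∈ S d) + B T T
        ≡⟨ cong (_+ B T T) (trans (∑∈-∁ T d) ∑d≡2e) ⟩
      2 * e ⊤ + B T T
        ≡⟨ cong (2 * e ⊤ +_) (e₂≡2e T) ⟩
      2 * e ⊤ + 2 * e T
        ≡⟨ *-distribˡ-+ 2 (e ⊤) (e T) ⟨
      2 * (e ⊤ + e T) ∎)
      where
      open ≡-Reasoning
      S = ∁ T

      B : Subset n → Subset n → ℕ
      B p q = ∑∈ p (λ u → ∑∈ q (A u))

      B-comm : B T S ≡ B S T
      B-comm = trans (∑∈-comm T S A) (∑∈-cong S (λ v → ∑∈-cong T (λ u → A-sym u v)))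

      degrees : ∀ p → ∑∈ p d ≡ B p T + B p S
      degrees p = trans (∑∈-cong p (λ u → trans (d≡∑A u) (sym (∑∈-∁ T (A u)))))
                        (∑∈-distrib-+ p (λ u → ∑∈ T (A u)) (λ u → ∑∈ S (A u)))

      regroup : ∀ x y z → x + 2 * (y + z) ≡ (y + z + (z + x)) + y
      regroup = solve-∀

    independent⇒e≡0 : ∀ T → (∀ {u v} → u ∈ T → v ∈ T → ¬ u ~ v) → e T ≡ 0
    independent⇒e≡0 T indep = *-cancelˡ-≡ (e T) 0 2 (n≤0⇒n≡0 (begin
      2 * e T                      ≡⟨ e₂≡2e T ⟨
      e₂ T                         ≤⟨ ∑∈-mono-≤ T (λ u u∈T → ∑∈-mono-≤ T (λ v v∈T →
                                        ≤-reflexive (bit-no (u ~? v) (indep u∈T v∈T)))) ⟩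
      ∑∈ T (λ _ → ∑∈ T (λ _ → 0))  ≡⟨ ∑∈-cong T (λ _ → ∑∈-0 T) ⟩
      ∑∈ T (λ _ → 0)               ≡⟨ ∑∈-0 T ⟩
      0                            ∎))
      where
      open ≤-Reasoning
      ∑∈-0 : ∀ p → ∑∈ p (λ _ → 0) ≡ 0
      ∑∈-0 p = trans (∑∈-const p 0) (*-zeroʳ ∣ p ∣)

    -- Two adjacent neighbours of `v` would form a triangle with `v`.
    independent : TriangleFree G → ∀ {v T} → T ⊆ N v → e T ≡ 0
    independent tf {v} {T} T⊆N = independent⇒e≡0 T λ u∈T w∈T u~w →
      tf v _ _ (∈N⇒~ (T⊆N u∈T)) u~w (∈N⇒~ (T⊆N w∈T))

    edges-∁-⊆N : TriangleFree G → ∀ {v T} → T ⊆ N v → e (∁ T) + ∑∈ T d ≡ e ⊤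
    edges-∁-⊆N tf {v} {T} T⊆N = trans (edges-∁ T) (trans
      (cong (e ⊤ +_) (independent tf {v} T⊆N))
      (+-identityʳ (e ⊤)))

    -- Deleting vertices together with edges.

    -- In the doubled count the row of `x` is subtracted exactly, while the column of `x` is only
    -- estimated by 0. Half of the true loss is enough to show that an edge disappears.
    edges-∖ : ∀ S {x} → x ∈ S → 2 * e (S ∖ x) + ∑∈ S (A x) ≤ 2 * e S
    edges-∖ S {x} x∈S = begin
      2 * e (S ∖ x) + ∑∈ S (A x)
        ≡⟨ cong (_+ ∑∈ S (A x)) (e₂≡2e (S ∖ x)) ⟨
      e₂ (S ∖ x) + ∑∈ S (A x)
        ≤⟨ +-monoˡ-≤ (∑∈ S (A x)) (∑∈-mono-≤ (S ∖ x) (λ u _ →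
             m+n≤o⇒m≤o (∑∈ (S ∖ x) (A u)) (≤-reflexive (∑∈-∖ S x∈S (A u))))) ⟩
      ∑∈ (S ∖ x) (λ u → ∑∈ S (A u)) + ∑∈ S (A x)
        ≡⟨ ∑∈-∖ S x∈S (λ u → ∑∈ S (A u)) ⟩
      e₂ S
        ≡⟨ e₂≡2e S ⟩
      2 * e S ∎
      where open ≤-Reasoning

    -- If `S` spans an edge, the degrees inside `S` have a positive sum, so some vertex has an edge
    -- to lose. If it spans none, any vertex of `S` will do, as `∸` truncates at 0.
    ∃-edge-killer : ∀ S → 0 < ∣ S ∣ → ∃[ x ] (x ∈ S × e (S ∖ x) ≤ e S ∸ 1)
    ∃-edge-killer S 0<∣S∣ with e S in eS
    ... | zero with x , x∈S , _ ← ∑∈-<⇒∃< S (λ _ → 0) (λ _ → 1)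
                     (subst₂ _<_ (sym (trans (∑∈-const S 0) (*-zeroʳ ∣ S ∣)))
                       (sym (trans (∑∈-const S 1) (*-identityʳ ∣ S ∣))) 0<∣S∣) =
      x , x∈S , *-cancelˡ-≤ 2 (m+n≤o⇒m≤o (2 * e (S ∖ x))
        (subst (λ t → 2 * e (S ∖ x) + ∑∈ S (A x) ≤ 2 * t) eS (edges-∖ S x∈S)))
    ... | suc k with x , x∈S , 0<deg ← ∑∈-<⇒∃< S (λ _ → 0) (λ u → ∑∈ S (A u))
                     (subst₂ _<_ (sym (trans (∑∈-const S 0) (*-zeroʳ ∣ S ∣)))
                       (sym (trans (e₂≡2e S) (cong (2 *_) eS))) z<s) =
      x , x∈S , s≤s⁻¹ (*-cancelˡ-< 2 _ _
        (<-≤-trans (m<m+n (2 * e (S ∖ x)) 0<deg)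
          (subst (λ t → 2 * e (S ∖ x) + ∑∈ S (A x) ≤ 2 * t) eS (edges-∖ S x∈S))))

    -- The extension of a neighbourhood to an m-set, seen from the complement: each of the `j`
    -- deleted vertices takes an edge with it as long as one is left.
    ∃-subset-killing : ∀ k j S → ∣ S ∣ ≡ j + k → ∃[ S′ ] (∣ S′ ∣ ≡ k × e S′ ≤ e S ∸ j)
    ∃-subset-killing k zero    S ∣S∣ = S , ∣S∣ , ≤-refl
    ∃-subset-killing k (suc j) S ∣S∣
      with x , x∈S , kill ← ∃-edge-killer S (subst (0 <_) (sym ∣S∣) z<s)
      with S′ , ∣S′∣ , le ← ∃-subset-killing k j (S ∖ x) (suc-injective (trans (∣∖∣ S x∈S) ∣S∣)) =
      S′ , ∣S′∣ , ≤-trans le (≤-trans (∸-monoˡ-≤ j kill) (≤-reflexive (∸-+-assoc (e S) 1 j)))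

    -- Degree sums over neighbourhoods, and the average degree.

    D : Fin n → ℕ
    D v = ∑∈ (N v) d

    -- After interchanging the summations, `d u` occurs once for each neighbour of `u`.
    ∑D≡∑d² : sum D ≡ ∑[ v < n ] (d v * d v)
    ∑D≡∑d² = begin
      sum D
        ≡⟨ sum-cong-≗ (λ v → sum-cong-≗ (λ u → cong (_* d u) (trans (χ-N v u) (A-sym v u)))) ⟩
      ∑[ v < n ] ∑[ u < n ] (A u v * d u)  ≡⟨ ∑-comm (λ v u → A u v * d u) ⟩
      ∑[ u < n ] ∑[ v < n ] (A u v * d u)  ≡⟨ sum-cong-≗ (λ u → *-distribʳ-sum (d u) (A u)) ⟨
      ∑[ u < n ] (sum (A u) * d u)         ≡⟨ sum-cong-≗ (λ u → cong (_* d u) (d≡∑A u)) ⟨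
      ∑[ v < n ] (d v * d v)               ∎
      where open ≡-Reasoning

    D≤dn : ∀ v → D v ≤ d v * n
    D≤dn v = begin
      ∑∈ (N v) d           ≤⟨ ∑∈-mono-≤ (N v) (λ u _ → d≤n u) ⟩
      ∑∈ (N v) (λ _ → n)   ≡⟨ ∑∈-const (N v) n ⟩
      ∣ N v ∣ * n          ≡⟨ cong (_* n) (∣N∣≡d v) ⟩
      d v * n              ∎
      where open ≤-Reasoning

    ∣∁∣≡ : ∀ {k m} T → k + m ≡ n → ∣ T ∣ ≡ m → ∣ ∁ T ∣ ≡ k
    ∣∁∣≡ {k} {m} T k+m≡n ∣T∣≡m = +-cancelˡ-≡ m _ k (begin
      m + ∣ ∁ T ∣      ≡⟨ cong (_+ ∣ ∁ T ∣) ∣T∣≡m ⟨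
      ∣ T ∣ + ∣ ∁ T ∣  ≡⟨ ∣∁∣ T ⟩
      n                ≡⟨ k+m≡n ⟨
      k + m            ≡⟨ +-comm k m ⟩
      m + k            ∎)
      where open ≡-Reasoning

    -- This is n d̄ by `∑d≡2e`: the average degree, scaled to be an integer.
    q : ℕ
    q = 2 * e ⊤

    -- Rewrites the rounded form of α + c ≥ 1 in terms of m = n - k. It amounts to n (m - 1) < e,
    -- that is, m - 1 < d̄/2.
    nm<n+e : ∀ {k m} → k + m ≡ n → n * n < n * suc k + e ⊤ → n * m < n + e ⊤
    nm<n+e {k} {m} k+m≡n n²< = +-cancelˡ-< (n * k) _ _ (subst₂ _<_
      (trans (cong (n *_) (sym k+m≡n)) (*-distribˡ-+ n k m)) (regroup n k (e ⊤)) n²<)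
      where
      regroup : ∀ n k e → n * suc k + e ≡ n * k + (n + e)
      regroup = solve-∀

    -- Density of all k-sets forces every degree to be the average.

    module _ (tf : TriangleFree G) {k m} (k+m≡n : k + m ≡ n) (0<m : 0 < m)
      (n*m<n+e : n * m < n + e ⊤) (dense : ∀ S → ∣ S ∣ ≡ k → n * e ⊤ ≤ n * e S + m * q) where

      -- Scaled by n, `dense` says that at most m d̄ edges meet the complement of a k-set. An
      -- above-average m-subset `T` of N(v) is independent, so the edges it meets number exactly its
      -- degree sum; hence the average degree over N(v) is at most d̄.
      high-degree : ∀ v → m ≤ d v → n * D v ≤ q * d v
      high-degree v m≤d
        with T , T⊆N , ∣T∣≡m , above ← ∃-above-average-subset m (d v ∸ m) (N v) d
               (trans (∣N∣≡d v) (sym (m∸n+n≡m m≤d))) =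
        *-cancelˡ-≤ m {{>-nonZero 0<m}} (begin
          m * (n * D v)                 ≡⟨ swap m n (D v) ⟩
          n * (m * D v)                 ≤⟨ *-monoʳ-≤ n above ⟩
          n * (∣ N v ∣ * ∑∈ T d)        ≡⟨ cong (λ t → n * (t * ∑∈ T d)) (∣N∣≡d v) ⟩
          n * (d v * ∑∈ T d)            ≡⟨ swap n (d v) (∑∈ T d) ⟩
          d v * (n * ∑∈ T d)            ≤⟨ *-monoʳ-≤ (d v) (+-cancelˡ-≤ (n * e (∁ T)) _ _ few) ⟩
          d v * (m * q)                 ≡⟨ trans (swap (d v) m q) (cong (m *_) (*-comm (d v) q)) ⟩
          m * (q * d v)                 ∎)
        where
        open ≤-Reasoning
        few : n * e (∁ T) + n * ∑∈ T d ≤ n * e (∁ T) + m * q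
        few = begin
          n * e (∁ T) + n * ∑∈ T d  ≡⟨ *-distribˡ-+ n (e (∁ T)) (∑∈ T d) ⟨
          n * (e (∁ T) + ∑∈ T d)    ≡⟨ cong (n *_) (edges-∁-⊆N tf {v} T⊆N) ⟩
          n * e ⊤                   ≤⟨ dense (∁ T) (∣∁∣≡ T k+m≡n ∣T∣≡m) ⟩
          n * e (∁ T) + m * q       ∎

      -- Here `suc i` is m - d(v). Deleting that many vertices from the complement of N(v) leaves a
      -- k-set and loses at least as many edges, on top of the D(v) edges meeting N(v); `dense`
      -- bounds the total by m d̄.
      low-degree : ∀ v i → suc (d v + i) ≡ m → n * (D v + suc i) ≤ m * q
      low-degree v i 1+d+i≡m = let S , ∣S∣≡k , eS≤ = ∃-subset-killing k (suc i) (∁ (N v)) ∣∁N∣ in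
        +-cancelˡ-≤ (n * e S) _ _ (begin
          n * e S + n * (D v + suc i)   ≡⟨ regroup n (e S) (D v) (suc i) ⟩
          n * (e S + suc i + D v)       ≤⟨ *-monoʳ-≤ n (+-monoˡ-≤ (D v)
               (≤-trans (+-monoˡ-≤ (suc i) eS≤) (≤-reflexive (m∸n+n≡m enough)))) ⟩
          n * (e (∁ (N v)) + D v)       ≡⟨ cong (n *_) split ⟩
          n * e ⊤                       ≤⟨ dense S ∣S∣≡k ⟩
          n * e S + m * q               ∎)
        where
        open ≤-Reasoning
        split : e (∁ (N v)) + D v ≡ e ⊤
        split = edges-∁-⊆N tf {v} (λ u∈N → u∈N)

        regroup : ∀ a b c d → a * b + a * (c + d) ≡ a * (b + d + c)
        regroup = solve-∀

        ∣∁N∣ : ∣ ∁ (N v) ∣ ≡ suc i + k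
        ∣∁N∣ = ∣∁∣≡ (N v) (trans (shuffle i k (d v)) (trans (cong (k +_) 1+d+i≡m) k+m≡n)) (∣N∣≡d v)
          where
          shuffle : ∀ i k d → suc i + k + d ≡ k + suc (d + i)
          shuffle = solve-∀

        -- Otherwise e ≤ i + d n, against n (d + i) < e.
        enough : suc i ≤ e (∁ (N v))
        enough = ≮⇒≥ λ e<1+i → contradiction n*m<n+e (≤⇒≯ (begin
          n + e ⊤                  ≡⟨ cong (n +_) split ⟨
          n + (e (∁ (N v)) + D v)  ≤⟨ +-monoʳ-≤ n (+-mono-≤ (s≤s⁻¹ e<1+i) (D≤dn v)) ⟩
          n + (i + d v * n)
            ≤⟨ +-monoʳ-≤ n (+-monoˡ-≤ (d v * n) (m≤n*m i n {{Fin.nonZeroIndex v}})) ⟩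
          n + (n * i + d v * n)    ≡⟨ collect n (d v) i ⟩
          n * suc (d v + i)        ≡⟨ cong (n *_) 1+d+i≡m ⟩
          n * m                    ∎))
          where
          collect : ∀ n d i → n + (n * i + d * n) ≡ n * suc (d + i)
          collect = solve-∀

      -- `low-degree` gives D(v) ≤ m d̄ - (m - d(v)), and `low-degree-bound` puts this strictly
      -- below d(v)² + d̄² - d̄ d(v).
      low-strict : ∀ v → d v < m → n * (n * D v) + n * (q * d v) < (n * d v) * (n * d v) + q * q
      low-strict v d<m with i , 1+d+i≡m ← m≤n⇒∃[o]m+o≡n d<m =
        -- Adding n² (m - d(v)) to both sides replaces the subtraction.
        +-cancelʳ-< (n * (n * suc i)) _ _ (begin-strict
          n * (n * D v) + n * (q * d v) + n * (n * suc i)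
            ≡⟨ regroup n (D v) (q * d v) (suc i) ⟩
          n * (n * (D v + suc i)) + n * (q * d v)
            ≤⟨ +-monoˡ-≤ (n * (q * d v)) (*-monoʳ-≤ n (low-degree v i 1+d+i≡m)) ⟩
          n * (m * q) + n * (q * d v)
            ≡⟨ cong (λ t → n * t + n * (q * d v)) (trans (*-comm m q) (cong (q *_) (sym 1+d+i≡m))) ⟩
          n * (q * suc (d v + i)) + n * (q * d v)
            <⟨ low-degree-bound n (d v) i q (*-monoʳ-< 2 n[d+i]<e) ⟩
          (n * d v) * (n * d v) + q * q + n * (n * suc i) ∎)
        where
        open ≤-Reasoning
        regroup : ∀ n a b c → n * (n * a) + n * b + n * (n * c) ≡ n * (n * (a + c)) + n * b
        regroup = solve-∀

        n[d+i]<e : n * (d v + i) < e ⊤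
        n[d+i]<e = +-cancelˡ-< n _ _ (subst (_< n + e ⊤)
          (trans (cong (n *_) (sym 1+d+i≡m)) (*-suc n (d v + i))) n*m<n+e)

      -- Kept apart from `bound` because the remaining gap is the square (n d(v) - q)², whose
      -- vanishing gives d(v) = d̄.
      high-bound : ∀ v → m ≤ d v → n * (n * D v) + n * (q * d v) ≤ 2 * (n * d v * q)
      high-bound v m≤d = begin
        n * (n * D v) + n * (q * d v)
          ≤⟨ +-monoˡ-≤ (n * (q * d v)) (*-monoʳ-≤ n (high-degree v m≤d)) ⟩
        n * (q * d v) + n * (q * d v)  ≡⟨ double n q (d v) ⟩
        2 * (n * d v * q)              ∎
        where
        open ≤-Reasoning
        double : ∀ n q d → n * (q * d) + n * (q * d) ≡ 2 * (n * d * q)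
        double = solve-∀

      -- This is D(v) ≤ d(v)² + d̄² - d̄ d(v), multiplied by n², with n d̄ = q.
      bound : ∀ v → n * (n * D v) + n * (q * d v) ≤ (n * d v) * (n * d v) + q * q
      bound v with ≤-<-connex m (d v)
      ... | inj₁ m≤d = ≤-trans (high-bound v m≤d) (2ab≤a²+b² (n * d v) q)
      ... | inj₂ d<m = <⇒≤ (low-strict v d<m)

      -- The squares of the degrees sum to the sum of `D` by `∑D≡∑d²`, and the n copies of q² match
      -- q times the degree sum by `∑d≡2e`.
      bound-sums : ∑[ v < n ] ((n * d v) * (n * d v) + q * q) ≡
                   ∑[ v < n ] (n * (n * D v) + n * (q * d v))
      bound-sums = begin
        ∑[ v < n ] ((n * d v) * (n * d v) + q * q)
          ≡⟨ ∑-distrib-+ (λ v → (n * d v) * (n * d v)) (λ _ → q * q) ⟩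
        ∑[ v < n ] ((n * d v) * (n * d v)) + ∑[ v < n ] (q * q)
          ≡⟨ cong₂ _+_
               (trans (sum-cong-≗ (λ v → square n (d v))) (pull (λ v → d v * d v)))
               (trans (sum-const n (q * q)) (cong (λ t → n * (q * t)) (sym ∑d≡2e))) ⟩
        n * (n * ∑[ v < n ] (d v * d v)) + n * (q * sum d)
          ≡⟨ cong₂ _+_
               (trans (cong (λ t → n * (n * t)) (sym ∑D≡∑d²)) (sym (pull D)))
               (trans (cong (n *_) (*-distribˡ-sum q d)) (*-distribˡ-sum n (λ v → q * d v))) ⟩
        ∑[ v < n ] (n * (n * D v)) + ∑[ v < n ] (n * (q * d v))
          ≡⟨ ∑-distrib-+ (λ v → n * (n * D v)) (λ v → n * (q * d v)) ⟨
        ∑[ v < n ] (n * (n * D v) + n * (q * d v)) ∎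
        where
        open ≡-Reasoning
        square : ∀ n d → (n * d) * (n * d) ≡ n * (n * (d * d))
        square = solve-∀
        pull : ∀ f → ∑[ v < n ] (n * (n * f v)) ≡ n * (n * sum f)
        pull f = sym (trans (cong (n *_) (*-distribˡ-sum n f)) (*-distribˡ-sum n (λ v → n * f v)))

      -- Equal sums make `bound` tight at `v`. Strictness rules out a degree below `m`; otherwise
      -- the equality case of `2ab≤a²+b²` applies.
      nd≡q : ∀ v → n * d v ≡ q
      nd≡q v with tight ← sum-mono-≤-tight bound (≤-reflexive bound-sums) v | ≤-<-connex m (d v)
      ... | inj₁ m≤d = a²+b²≤2ab⇒a≡b (n * d v) q (≤-trans tight (high-bound v m≤d))
      ... | inj₂ d<m = contradiction tight (<⇒≱ (low-strict v d<m))

    -- Edge counts in regular graphs, and sparse sets.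

    ∑∈-degrees : (∀ v → n * d v ≡ q) → ∀ T → n * ∑∈ T d ≡ ∣ T ∣ * q
    ∑∈-degrees nd≡q T = trans (*-distribˡ-∑∈ T n d) (trans (∑∈-cong T nd≡q) (∑∈-const T q))

    regular⇒nd≡q : Regular G → ∀ v → n * d v ≡ q
    regular⇒nd≡q reg v = trans (sym (sum-const n (d v))) (trans (sum-cong-≗ (reg v)) ∑d≡2e)

    -- Translates between n e ≷ n e(S) + m q and the subtraction-free 2 k e ≷ n (e(S) + e).
    2ke+mq : ∀ k m → k + m ≡ n → 2 * (k * e ⊤) + m * q ≡ n * e ⊤ + n * e ⊤
    2ke+mq k m k+m≡n =
      subst (λ t → 2 * (k * e ⊤) + m * q ≡ t * e ⊤ + t * e ⊤) k+m≡n (identity k m (e ⊤))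
      where
      identity : ∀ k m e → 2 * (k * e) + m * (2 * e) ≡ (k + m) * e + (k + m) * e
      identity = solve-∀

    -- The degree sum over `T` is m d̄, so `edges-∁` determines e(∁ T) up to e(T). Nonnegativity of
    -- e(T) gives the lower bound for every k-set, and e(T) = 0 gives a k-set attaining it.
    edges-∁-equiregular : (∀ v → n * d v ≡ q) → ∀ {k m} → k + m ≡ n → ∀ T → ∣ T ∣ ≡ m →
      n * (e (∁ T) + e ⊤) ≡ 2 * (k * e ⊤) + n * e T
    edges-∁-equiregular nd≡q {k} {m} k+m≡n T ∣T∣≡m = +-cancelʳ-≡ (m * q) _ _ (begin
      n * (e (∁ T) + e ⊤) + m * q
        ≡⟨ cong (n * (e (∁ T) + e ⊤) +_) (trans (∑∈-degrees nd≡q T) (cong (_* q) ∣T∣≡m)) ⟨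
      n * (e (∁ T) + e ⊤) + n * ∑∈ T d
        ≡⟨ regroup n (e (∁ T)) (e ⊤) (∑∈ T d) ⟩
      n * (e (∁ T) + ∑∈ T d) + n * e ⊤
        ≡⟨ cong (λ t → n * t + n * e ⊤) (edges-∁ T) ⟩
      n * (e ⊤ + e T) + n * e ⊤
        ≡⟨ regroup′ n (e ⊤) (e T) ⟩
      n * e ⊤ + n * e ⊤ + n * e T
        ≡⟨ cong (_+ n * e T) (2ke+mq k m k+m≡n) ⟨
      2 * (k * e ⊤) + m * q + n * e T
        ≡⟨ +-assoc (2 * (k * e ⊤)) (m * q) (n * e T) ⟩
      2 * (k * e ⊤) + (m * q + n * e T)
        ≡⟨ cong (2 * (k * e ⊤) +_) (+-comm (m * q) (n * e T)) ⟩
      2 * (k * e ⊤) + (n * e T + m * q)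
        ≡⟨ +-assoc (2 * (k * e ⊤)) (n * e T) (m * q) ⟨
      2 * (k * e ⊤) + n * e T + m * q ∎)
      where
      open ≡-Reasoning
      regroup : ∀ n a b c → n * (a + b) + n * c ≡ n * (a + c) + n * b
      regroup = solve-∀
      regroup′ : ∀ n a b → n * (a + b) + n * a ≡ n * a + n * a + n * b
      regroup′ = solve-∀

    regular⇒dense : Regular G → ∀ S → 2 * (∣ S ∣ * e ⊤) ≤ n * (e S + e ⊤)
    regular⇒dense reg S = begin
      2 * (∣ S ∣ * e ⊤)                     ≤⟨ m≤m+n _ (n * e (∁ S)) ⟩
      2 * (∣ S ∣ * e ⊤) + n * e (∁ S)
        ≡⟨ edges-∁-equiregular (regular⇒nd≡q reg) (∣∁∣ S) (∁ S) refl ⟨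
      n * (e (∁ (∁ S)) + e ⊤)               ≡⟨ cong (λ p → n * (e p + e ⊤)) (∁∁ S) ⟩
      n * (e S + e ⊤)                       ∎
      where open ≤-Reasoning

    -- k < n makes m = n - k positive, as needed for the division by m in `high-degree`.
    dense⇒nd≡q : TriangleFree G → ∀ {k} → k < n → n * n < n * suc k + e ⊤ →
      (∀ S → ∣ S ∣ ≡ k → 2 * (k * e ⊤) ≤ n * (e S + e ⊤)) → ∀ v → n * d v ≡ q
    dense⇒nd≡q tf {k} k<n n²< dense = nd≡q tf k+m≡n (m<n⇒0<n∸m k<n) (nm<n+e {k} k+m≡n n²<) λ S ∣S∣≡k →
      +-cancelʳ-≤ (n * e ⊤) _ _ (begin
        n * e ⊤ + n * e ⊤              ≡⟨ 2ke+mq k m k+m≡n ⟨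
        2 * (k * e ⊤) + m * q          ≤⟨ +-monoˡ-≤ (m * q) (dense S ∣S∣≡k) ⟩
        n * (e S + e ⊤) + m * q        ≡⟨ regroup n (e S) (e ⊤) (m * q) ⟩
        n * e S + m * q + n * e ⊤      ∎)
      where
      open ≤-Reasoning
      m = n ∸ k
      k+m≡n = m+[n∸m]≡n (<⇒≤ k<n)
      regroup : ∀ n a b c → n * (a + b) + c ≡ n * a + c + n * b
      regroup = solve-∀

    dense⇒regular : TriangleFree G → ∀ {k} → k < n → n * n < n * suc k + e ⊤ →
      (∀ S → ∣ S ∣ ≡ k → 2 * (k * e ⊤) ≤ n * (e S + e ⊤)) → Regular G
    dense⇒regular tf {k} k<n n²< dense u v =
      *-cancelˡ-≡ (d u) (d v) n {{Fin.nonZeroIndex u}} (trans (nd≡q′ u) (sym (nd≡q′ v)))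
      where nd≡q′ = dense⇒nd≡q tf {k} k<n n²< dense

    equiregular⇒∃-sparse : TriangleFree G → (∀ v → n * d v ≡ q) →
      ∀ {k m} → k + m ≡ n → n * m < n + e ⊤ → Fin n →
      ∃[ S ] (∣ S ∣ ≡ k × n * (e S + e ⊤) ≤ 2 * (k * e ⊤))
    equiregular⇒∃-sparse tf nd≡q {k} {m} k+m≡n n*m<n+e v =
      -- `∃-above-average-subset` serves here to pick some m-subset of N(v), which is then
      -- independent.
      let T , T⊆N , ∣T∣≡m , _ = ∃-above-average-subset m (d v ∸ m) (N v) d
            (trans (∣N∣≡d v) (sym (m∸n+n≡m m≤d))) in
      ∁ T , ∣∁∣≡ T k+m≡n ∣T∣≡m , (begin
        n * (e (∁ T) + e ⊤)        ≡⟨ edges-∁-equiregular nd≡q k+m≡n T ∣T∣≡m ⟩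
        2 * (k * e ⊤) + n * e T    ≡⟨ cong (λ t → 2 * (k * e ⊤) + n * t) (independent tf {v} T⊆N) ⟩
        2 * (k * e ⊤) + n * 0      ≡⟨ cong (2 * (k * e ⊤) +_) (*-zeroʳ n) ⟩
        2 * (k * e ⊤) + 0          ≡⟨ +-identityʳ _ ⟩
        2 * (k * e ⊤)              ∎)
      where
      open ≤-Reasoning
      -- If d(v) + 1 ≤ m, then n m ≥ n + n d(v) = n + 2 e ≥ n + e.
      m≤d : m ≤ d v
      m≤d = ≮⇒≥ λ d<m → contradiction n*m<n+e (≤⇒≯ (begin
        n + e ⊤       ≤⟨ +-monoʳ-≤ n (m≤m+n (e ⊤) _) ⟩
        n + q         ≡⟨ cong (n +_) (nd≡q v) ⟨
        n + n * d v   ≡⟨ *-suc n (d v) ⟨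
        n * suc (d v) ≤⟨ *-monoʳ-≤ n d<m ⟩
        n * m         ∎))

    -- A search through the finitely many subsets replaces the argument by contradiction. If it
    -- fails, all k-sets are dense, so all degrees are equal, and a neighbourhood then yields a
    -- sparse set. For k = n the full vertex set attains equality.
    ∃-sparse : TriangleFree G → ∀ {k} → k ≤ n → n * n < n * suc k + e ⊤ →
      ∃[ S ] (∣ S ∣ ≡ k × n * (e S + e ⊤) ≤ 2 * (k * e ⊤))
    ∃-sparse tf {k} k≤n n²<
      with Sub.anySubset? (λ S → (∣ S ∣ ≟ k) ×-dec (n * (e S + e ⊤) ≤? 2 * (k * e ⊤)))
         | m≤n⇒m<n∨m≡n k≤n
    ... | yes found | _         = found
    ... | no  none  | inj₂ refl = ⊤ , Sub.∣⊤∣≡n n , ≤-reflexive (double n (e ⊤))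
      where
      double : ∀ n e → n * (e + e) ≡ 2 * (n * e)
      double = solve-∀
    ... | no  none  | inj₁ k<n  = equiregular⇒∃-sparse tf
      (dense⇒nd≡q tf {k} k<n n²< λ S ∣S∣≡k →
        <⇒≤ (≰⇒> (λ sparse → none (S , ∣S∣≡k , sparse))))
      (m+[n∸m]≡n k≤n) (nm<n+e {k} (m+[n∸m]≡n k≤n) n²<) (fromℕ< k<n)

open import Defs

-- The embedding of the naturals into the rationals.

ι : ℕ → ℚ
ι n = ℤ.+ n ℚ./ 1

private
  -- The fraction n/1 already in lowest terms: its numerator and denominator compute, whereas those
  -- of `ι n` wait for a gcd.
  ι′ : ℕ → ℚ
  ι′ n = mkℚ (ℤ.+ n) 0 (Coprime.sym (1-coprimeTo n))

  ι≡ι′ : ∀ n → ι n ≡ ι′ n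
  ι≡ι′ n = ℚₚ.normalize-coprime (Coprime.sym (1-coprimeTo n))

ι-+ : ∀ m n → ι (m ℕ.+ n) ≡ ι m ℚ.+ ι n
ι-+ m n rewrite ι≡ι′ m | ι≡ι′ n =
  cong (ℚ._/ 1) (sym (cong₂ ℤ._+_ (ℤₚ.*-identityʳ (ℤ.+ m)) (ℤₚ.*-identityʳ (ℤ.+ n))))

ι-* : ∀ m n → ι (m ℕ.* n) ≡ ι m ℚ.* ι n
ι-* m n rewrite ι≡ι′ m | ι≡ι′ n = cong (ℚ._/ 1) (ℤₚ.pos-* m n)

ι-mono-≤ : ∀ {m n} → m ℕ.≤ n → ι m ℚ.≤ ι n
ι-mono-≤ {m} {n} m≤n rewrite ι≡ι′ m | ι≡ι′ n =
  ℚ.*≤* (ℤₚ.*-monoʳ-≤-nonNeg (ℤ.+ 1) (ℤ.+≤+ m≤n))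

ι-mono-< : ∀ {m n} → m ℕ.< n → ι m ℚ.< ι n
ι-mono-< {m} {n} m<n rewrite ι≡ι′ m | ι≡ι′ n =
  ℚ.*<* (ℤₚ.*-monoʳ-<-pos (ℤ.+ 1) (ℤ.+<+ m<n))

0≤ι : ∀ n → 0ℚ ℚ.≤ ι n
0≤ι n = ι-mono-≤ {0} {n} ℕ.z≤n

-- δ is ε/(1 + a); the 1 keeps the denominator positive when a = 0.
shrink : ∀ a ε → 0ℚ ℚ.≤ a → 0ℚ ℚ.< ε → ∃[ δ ] (0ℚ ℚ.< δ × a ℚ.* δ ℚ.≤ ε)
shrink a ε 0≤a 0<ε = δ , ℚₚ.positive⁻¹ δ , (begin
  a ℚ.* δ          ≤⟨ ℚₚ.*-monoʳ-≤-nonNeg δ {{ℚₚ.pos⇒nonNeg δ}} a≤b ⟩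
  b ℚ.* δ          ≡⟨ ℚₚ.*-assoc b b⁻¹ ε ⟨
  b ℚ.* b⁻¹ ℚ.* ε  ≡⟨ cong (ℚ._* ε) (ℚₚ.*-inverseʳ b) ⟩
  1ℚ ℚ.* ε         ≡⟨ ℚₚ.*-identityˡ ε ⟩
  ε                ∎)
  where
  open ℚₚ.≤-Reasoning
  b = 1ℚ ℚ.+ a
  instance
    b-pos : ℚ.Positive b
    b-pos = ℚ.positive (ℚₚ.+-mono-<-≤ (ℚₚ.positive⁻¹ 1ℚ) 0≤a)
    b-nonZero : ℚ.NonZero b
    b-nonZero = ℚₚ.pos⇒nonZero b
    ε-pos : ℚ.Positive ε
    ε-pos = ℚ.positive 0<ε
  b⁻¹ = ℚ.1/ b
  δ = b⁻¹ ℚ.* ε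
  instance
    δ-pos : ℚ.Positive δ
    δ-pos = ℚₚ.pos*pos⇒pos b⁻¹ {{ℚₚ.1/pos⇒pos b}} ε
  a≤b : a ℚ.≤ b
  a≤b = subst (ℚ._≤ b) (ℚₚ.+-identityˡ a) (ℚₚ.+-monoˡ-≤ a (ℚₚ.nonNegative⁻¹ 1ℚ))

-- Order and equality of the reals.

p≤p+ε : ∀ p {ε} → 0ℚ ℚ.≤ ε → p ℚ.≤ p ℚ.+ ε
p≤p+ε p {ε} 0≤ε = subst (ℚ._≤ p ℚ.+ ε) (ℚₚ.+-identityʳ p) (ℚₚ.+-monoʳ-≤ p 0≤ε)

≤-pointwise : ∀ x y → (∀ i → seq x i ℚ.≤ seq y i) → x ≤ y
≤-pointwise x y x≤y ε 0<ε = 0 , λ i _ → ℚₚ.≤-trans (x≤y i) (p≤p+ε (seq y i) (ℚₚ.<⇒≤ 0<ε))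

-- Ring identities hold at each index of the sequences, so they enter chains of inequalities through
-- this termwise form.
≤-reflexive : ∀ x y → (∀ i → seq x i ≡ seq y i) → x ≤ y
≤-reflexive x y x≡y = ≤-pointwise x y (λ i → ℚₚ.≤-reflexive (x≡y i))

private
  halve : ∀ ε → 0ℚ ℚ.< ε → ∃[ η ] (0ℚ ℚ.< η × η ℚ.+ η ℚ.≤ ε)
  halve ε 0<ε with η , 0<η , 2η≤ε ← shrink (ι 2) ε (0≤ι 2) 0<ε =
    η , 0<η , subst (ℚ._≤ ε) (solve 1 (λ η → con (ι 2) :* η := η :+ η) refl η) 2η≤ε
    where open +-*-Solver

≤-trans : ∀ x y z → x ≤ y → y ≤ z → x ≤ z
≤-trans x y z x≤y y≤z ε 0<ε =
  let
    η , 0<η , 2η≤ε = halve ε 0<ε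
    M , f = x≤y η 0<η
    N , g = y≤z η 0<η
  in M ℕ.⊔ N , λ i i≥ → begin
    seq x i                   ≤⟨ f i (ℕₚ.m⊔n≤o⇒m≤o M N i≥) ⟩
    seq y i ℚ.+ η             ≤⟨ ℚₚ.+-monoˡ-≤ η (g i (ℕₚ.m⊔n≤o⇒n≤o M N i≥)) ⟩
    seq z i ℚ.+ η ℚ.+ η       ≡⟨ ℚₚ.+-assoc (seq z i) η η ⟩
    seq z i ℚ.+ (η ℚ.+ η)     ≤⟨ ℚₚ.+-monoʳ-≤ (seq z i) 2η≤ε ⟩
    seq z i ℚ.+ ε             ∎
  where open ℚₚ.≤-Reasoning

module ≤-Reasoning = SingleReasoning _≤_
  (λ {x} → ≤-reflexive x x (λ _ → refl)) (λ {x y z} → ≤-trans x y z)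

≃-sym : ∀ x y → x ≃ y → y ≃ x
≃-sym x y x≃y ε 0<ε with N , f ← x≃y ε 0<ε =
  N , λ i N≤i → subst (ℚ._≤ ε)
    (trans (sym (ℚₚ.∣-p∣≡∣p∣ (seq x i ℚ.- seq y i)))
      (cong ℚ.∣_∣ (solve 2 (λ a b → :- (a :- b) := b :- a) refl (seq x i) (seq y i))))
    (f i N≤i)
  where open +-*-Solver

≃⇒≤ : ∀ x y → x ≃ y → x ≤ y
≃⇒≤ x y x≃y ε 0<ε with N , f ← x≃y ε 0<ε = N , λ i N≤i → begin
  seq x i
    ≡⟨ solve 2 (λ a b → a := b :+ (a :- b)) refl (seq x i) (seq y i) ⟩
  seq y i ℚ.+ (seq x i ℚ.- seq y i)   ≤⟨ ℚₚ.+-monoʳ-≤ (seq y i) (ℚₚ.≤-trans (p≤∣p∣ _) (f i N≤i)) ⟩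
  seq y i ℚ.+ ε                       ∎
  where
  open ℚₚ.≤-Reasoning
  open +-*-Solver
  p≤∣p∣ : ∀ p → p ℚ.≤ ℚ.∣ p ∣
  p≤∣p∣ p with ℚₚ.≤-total p 0ℚ
  ... | inj₁ p≤0 = ℚₚ.≤-trans p≤0 (ℚₚ.0≤∣p∣ p)
  ... | inj₂ 0≤p = ℚₚ.≤-reflexive (sym (ℚₚ.0≤p⇒∣p∣≡p 0≤p))

<⇒≱ : ∀ x y → x < y → ¬ (y ≤ x)
<⇒≱ x y (ε , 0<ε , M , f) y≤x =
  let
    -- Taking η as tolerance for y ≤ x contradicts the gap ε, since η < η + η ≤ ε.
    η , 0<η , 2η≤ε = halve ε 0<ε
    N , g = y≤x η 0<η
    i = M ℕ.⊔ N
  in ℚₚ.<-irrefl refl (begin-strict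
    seq x i ℚ.+ ε          ≤⟨ f i (ℕₚ.m≤m⊔n M N) ⟩
    seq y i                ≤⟨ g i (ℕₚ.m≤n⊔m M N) ⟩
    seq x i ℚ.+ η          ≡⟨ cong (seq x i ℚ.+_) (ℚₚ.+-identityʳ η) ⟨
    seq x i ℚ.+ (η ℚ.+ 0ℚ) <⟨ ℚₚ.+-monoʳ-< (seq x i) (ℚₚ.+-monoʳ-< η 0<η) ⟩
    seq x i ℚ.+ (η ℚ.+ η)  ≤⟨ ℚₚ.+-monoʳ-≤ (seq x i) 2η≤ε ⟩
    seq x i ℚ.+ ε          ∎)
  where open ℚₚ.≤-Reasoning

fromℕ-mono-≤ : ∀ {m n} → m ℕ.≤ n → fromℕ m ≤ fromℕ n
fromℕ-mono-≤ {m} {n} m≤n = ≤-pointwise (fromℕ m) (fromℕ n) (λ _ → ι-mono-≤ m≤n)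

fromℕ-mono-< : ∀ {m n} → m ℕ.< n → fromℕ m < fromℕ n
fromℕ-mono-< {m} {n} m<n = 1ℚ , ℚₚ.positive⁻¹ 1ℚ , 0 , λ _ _ →
  ℚₚ.≤-trans (ℚₚ.≤-reflexive (trans (ℚₚ.+-comm (ι m) 1ℚ) (sym (ι-+ 1 m)))) (ι-mono-≤ m<n)

fromℕ-cancel-≤ : ∀ {m n} → fromℕ m ≤ fromℕ n → m ℕ.≤ n
fromℕ-cancel-≤ {m} {n} m≤n = ℕₚ.≮⇒≥ λ n<m → <⇒≱ (fromℕ n) (fromℕ m) (fromℕ-mono-< n<m) m≤n

+-monoˡ-≤ : ∀ z x y → x ≤ y → x + z ≤ y + z
+-monoˡ-≤ z x y x≤y ε 0<ε with N , f ← x≤y ε 0<ε = N , λ i N≤i → begin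
  seq x i ℚ.+ seq z i        ≤⟨ ℚₚ.+-monoˡ-≤ (seq z i) (f i N≤i) ⟩
  seq y i ℚ.+ ε ℚ.+ seq z i
    ≡⟨ solve 3 (λ y ε z → y :+ ε :+ z := y :+ z :+ ε) refl (seq y i) ε (seq z i) ⟩
  seq y i ℚ.+ seq z i ℚ.+ ε  ∎
  where
  open ℚₚ.≤-Reasoning
  open +-*-Solver

+-cancelʳ-≤ : ∀ z x y → x + z ≤ y + z → x ≤ y
+-cancelʳ-≤ z x y x+z≤y+z = begin
  x          ∼⟨ ≤-reflexive x (x + z - z) (λ i → cancel (seq x i) (seq z i)) ⟩
  x + z - z  ∼⟨ +-monoˡ-≤ (- z) (x + z) (y + z) x+z≤y+z ⟩
  y + z - z  ∼⟨ ≤-reflexive (y + z - z) y (λ i → sym (cancel (seq y i) (seq z i))) ⟩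
  y          ∎
  where
  open ≤-Reasoning
  open +-*-Solver
  cancel : ∀ a b → a ≡ a ℚ.+ b ℚ.- b
  cancel = solve 2 (λ a b → a := a :+ b :- b) refl

*-monoʳ-≤ : ∀ a x y → x ≤ y → fromℕ a * x ≤ fromℕ a * y
*-monoʳ-≤ a x y x≤y ε 0<ε =
  let
    δ , 0<δ , aδ≤ε = shrink (ι a) ε (0≤ι a) 0<ε
    N , f = x≤y δ 0<δ
  in N , λ i N≤i → begin
    ι a ℚ.* seq x i              ≤⟨ ℚₚ.*-monoˡ-≤-nonNeg (ι a) {{ℚ.nonNegative (0≤ι a)}} (f i N≤i) ⟩
    ι a ℚ.* (seq y i ℚ.+ δ)      ≡⟨ ℚₚ.*-distribˡ-+ (ι a) (seq y i) δ ⟩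
    ι a ℚ.* seq y i ℚ.+ ι a ℚ.* δ  ≤⟨ ℚₚ.+-monoʳ-≤ (ι a ℚ.* seq y i) aδ≤ε ⟩
    ι a ℚ.* seq y i ℚ.+ ε        ∎
  where open ℚₚ.≤-Reasoning

-- The same index works for ε, because a ≥ 1 gives ε ≤ a ε.
*-cancelˡ-≤ : ∀ a .{{_ : ℕ.NonZero a}} x y → fromℕ a * x ≤ fromℕ a * y → x ≤ y
*-cancelˡ-≤ a@(suc b) x y ax≤ay ε 0<ε with N , f ← ax≤ay ε 0<ε = N , λ i N≤i →
  ℚₚ.*-cancelˡ-≤-pos (ι a) {{ℚ.positive (ι-mono-< {0} {a} ℕ.z<s)}} (begin
    ι a ℚ.* seq x i                ≤⟨ f i N≤i ⟩
    ι a ℚ.* seq y i ℚ.+ ε          ≤⟨ ℚₚ.+-monoʳ-≤ (ι a ℚ.* seq y i) ε≤aε ⟩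
    ι a ℚ.* seq y i ℚ.+ ι a ℚ.* ε  ≡⟨ ℚₚ.*-distribˡ-+ (ι a) (seq y i) ε ⟨
    ι a ℚ.* (seq y i ℚ.+ ε)        ∎)
  where
  open ℚₚ.≤-Reasoning
  ε≤aε : ε ℚ.≤ ι a ℚ.* ε
  ε≤aε = subst (ℚ._≤ ι a ℚ.* ε) (ℚₚ.*-identityˡ ε)
    (ℚₚ.*-monoʳ-≤-nonNeg ε {{ℚ.nonNegative (ℚₚ.<⇒≤ 0<ε)}} (ι-mono-≤ {1} {a} (ℕ.s≤s ℕ.z≤n)))

-- From some index on, every term is within 1 of one fixed term.
bounded : ∀ x → ∃[ B ] (0ℚ ℚ.≤ B × ∃[ N ] (∀ i → N ℕ.≤ i → ℚ.∣ seq x i ∣ ℚ.≤ B))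
bounded x with N , f ← cauchy x 1ℚ (ℚₚ.positive⁻¹ 1ℚ) =
  1ℚ ℚ.+ ℚ.∣ seq x N ∣ ,
  ℚₚ.+-mono-≤ (ℚₚ.nonNegative⁻¹ 1ℚ) (ℚₚ.0≤∣p∣ (seq x N)) ,
  N , λ i N≤i → begin
    ℚ.∣ seq x i ∣
      ≡⟨ cong ℚ.∣_∣ (solve 2 (λ a b → a := (a :- b) :+ b) refl (seq x i) (seq x N)) ⟩
    ℚ.∣ (seq x i ℚ.- seq x N) ℚ.+ seq x N ∣
      ≤⟨ ℚₚ.∣p+q∣≤∣p∣+∣q∣ (seq x i ℚ.- seq x N) (seq x N) ⟩
    ℚ.∣ seq x i ℚ.- seq x N ∣ ℚ.+ ℚ.∣ seq x N ∣
      ≤⟨ ℚₚ.+-monoˡ-≤ ℚ.∣ seq x N ∣ (f i N N≤i ℕₚ.≤-refl) ⟩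
    1ℚ ℚ.+ ℚ.∣ seq x N ∣ ∎
  where
  open ℚₚ.≤-Reasoning
  open +-*-Solver

*-congˡ : ∀ x y z → y ≃ z → x * y ≃ x * z
*-congˡ x y z y≃z ε 0<ε =
  let
    B , 0≤B , M , h = bounded x
    δ , 0<δ , Bδ≤ε = shrink B ε 0≤B 0<ε
    N , f = y≃z δ 0<δ
  in M ℕ.⊔ N , λ i i≥ → begin
    ℚ.∣ seq x i ℚ.* seq y i ℚ.- seq x i ℚ.* seq z i ∣
      ≡⟨ cong ℚ.∣_∣ (solve 3 (λ a b c → a :* b :- a :* c := a :* (b :- c)) refl
           (seq x i) (seq y i) (seq z i)) ⟩
    ℚ.∣ seq x i ℚ.* (seq y i ℚ.- seq z i) ∣
      ≡⟨ ℚₚ.∣p*q∣≡∣p∣*∣q∣ (seq x i) (seq y i ℚ.- seq z i) ⟩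
    ℚ.∣ seq x i ∣ ℚ.* ℚ.∣ seq y i ℚ.- seq z i ∣
      ≤⟨ ℚₚ.*-monoˡ-≤-nonNeg ℚ.∣ seq x i ∣ {{ℚ.nonNegative (ℚₚ.0≤∣p∣ (seq x i))}}
           (f i (ℕₚ.m⊔n≤o⇒n≤o M N i≥)) ⟩
    ℚ.∣ seq x i ∣ ℚ.* δ
      ≤⟨ ℚₚ.*-monoʳ-≤-nonNeg δ {{ℚ.nonNegative (ℚₚ.<⇒≤ 0<δ)}} (h i (ℕₚ.m⊔n≤o⇒m≤o M N i≥)) ⟩
    B ℚ.* δ
      ≤⟨ Bδ≤ε ⟩
    ε ∎
  where
  open ℚₚ.≤-Reasoning
  open +-*-Solver

-- Translation between the real bound and comparisons of naturals.

module _ (α c : ℝ) (n e : ℕ) .{{_ : ℕ.NonZero n}}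
  (e≃cn² : fromℕ e ≃ c * (fromℕ n * fromℕ n)) where

  private
    open +-*-Solver
    N  = fromℕ n
    E  = fromℕ e
    -- `r` is the bound of the theorem and `r′` has e in place of c n². The regrouped `r″` links
    -- them, as c n² is one factor there and `*-congˡ` applies.
    r  = (2ℝ * α - 1ℝ) * c * (N * N)
    r′ = (2ℝ * α - 1ℝ) * E
    r″ = (2ℝ * α - 1ℝ) * (c * (N * N))

    r-assoc : ∀ i → seq r i ≡ seq r″ i
    r-assoc i = ℚₚ.*-assoc (seq (2ℝ * α - 1ℝ) i) (seq c i) (seq (N * N) i)

    r≤r′ : r ≤ r′
    r≤r′ = ≤-trans r r″ r′ (≤-reflexive r r″ r-assoc)
      (≃⇒≤ r″ r′ (*-congˡ (2ℝ * α - 1ℝ) (c * (N * N)) E (≃-sym E (c * (N * N)) e≃cn²)))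

    r′≤r : r′ ≤ r
    r′≤r = ≤-trans r′ r″ r (≃⇒≤ r′ r″ (*-congˡ (2ℝ * α - 1ℝ) E (c * (N * N)) e≃cn²))
      (≤-reflexive r″ r (sym ∘ r-assoc))

    -- Adding e to (2 α - 1) e leaves 2 α e. So the bound becomes a comparison of n (s + e) with 2 e
    -- (α n), without subtraction.
    scaled-r′ : ∀ i → seq (N * (r′ + E)) i ≡ seq (fromℕ (2 ℕ.* e) * (α * N)) i
    scaled-r′ i = trans
      (solve 3 (λ n a e →
        n :* ((con (ι 2) :* a :+ :- con (ι 1)) :* e :+ e) := con (ι 2) :* e :* (a :* n)) refl
        (ι n) (seq α i) (ι e))
      (cong (ℚ._* (seq α i ℚ.* ι n)) (sym (ι-* 2 e)))

    scaled-sum : ∀ s → ι (n ℕ.* (s ℕ.+ e)) ≡ ι n ℚ.* (ι s ℚ.+ ι e)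
    scaled-sum s = trans (ι-* n (s ℕ.+ e)) (cong (ι n ℚ.*_) (ι-+ s e))

    2ke : ∀ k → ι (2 ℕ.* (k ℕ.* e)) ≡ ι (2 ℕ.* e) ℚ.* ι k
    2ke k = trans (cong ι (identity k e)) (ι-* (2 ℕ.* e) k)
      where
      identity : ∀ k e → 2 ℕ.* (k ℕ.* e) ≡ 2 ℕ.* e ℕ.* k
      identity = solve-∀

  open ≤-Reasoning

  -- Rounding α n down to `k` is harmless even where 2 α - 1 is negative: after adding e, the
  -- coefficient of α n is 2 e ≥ 0.
  sparse-≤ : ∀ k s → fromℕ k ≤ α * N → n ℕ.* (s ℕ.+ e) ℕ.≤ 2 ℕ.* (k ℕ.* e) → fromℕ s ≤ r
  sparse-≤ k s k≤αn sparse = ≤-trans (fromℕ s) r′ r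
    (+-cancelʳ-≤ E (fromℕ s) r′ (*-cancelˡ-≤ n (fromℕ s + E) (r′ + E) (begin
      N * (fromℕ s + E)
        ∼⟨ ≤-reflexive (N * (fromℕ s + E)) (fromℕ (n ℕ.* (s ℕ.+ e))) (λ _ → sym (scaled-sum s)) ⟩
      fromℕ (n ℕ.* (s ℕ.+ e))        ∼⟨ fromℕ-mono-≤ sparse ⟩
      fromℕ (2 ℕ.* (k ℕ.* e))
        ∼⟨ ≤-reflexive (fromℕ (2 ℕ.* (k ℕ.* e))) (fromℕ (2 ℕ.* e) * fromℕ k) (λ _ → 2ke k) ⟩
      fromℕ (2 ℕ.* e) * fromℕ k      ∼⟨ *-monoʳ-≤ (2 ℕ.* e) (fromℕ k) (α * N) k≤αn ⟩
      fromℕ (2 ℕ.* e) * (α * N)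
        ∼⟨ ≤-reflexive (fromℕ (2 ℕ.* e) * (α * N)) (N * (r′ + E)) (sym ∘ scaled-r′) ⟩
      N * (r′ + E)                   ∎)))
    r′≤r

  dense-≤ : ∀ k s → α * N ≤ fromℕ k → 2 ℕ.* (k ℕ.* e) ℕ.≤ n ℕ.* (s ℕ.+ e) → r ≤ fromℕ s
  dense-≤ k s αn≤k dense = ≤-trans r r′ (fromℕ s) r≤r′
    (+-cancelʳ-≤ E r′ (fromℕ s) (*-cancelˡ-≤ n (r′ + E) (fromℕ s + E) (begin
      N * (r′ + E)
        ∼⟨ ≤-reflexive (N * (r′ + E)) (fromℕ (2 ℕ.* e) * (α * N)) scaled-r′ ⟩
      fromℕ (2 ℕ.* e) * (α * N)      ∼⟨ *-monoʳ-≤ (2 ℕ.* e) (α * N) (fromℕ k) αn≤k ⟩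
      fromℕ (2 ℕ.* e) * fromℕ k
        ∼⟨ ≤-reflexive (fromℕ (2 ℕ.* e) * fromℕ k) (fromℕ (2 ℕ.* (k ℕ.* e))) (λ _ → sym (2ke k)) ⟩
      fromℕ (2 ℕ.* (k ℕ.* e))        ∼⟨ fromℕ-mono-≤ dense ⟩
      fromℕ (n ℕ.* (s ℕ.+ e))
        ∼⟨ ≤-reflexive (fromℕ (n ℕ.* (s ℕ.+ e))) (N * (fromℕ s + E)) (λ _ → scaled-sum s) ⟩
      N * (fromℕ s + E)              ∎)))

  ≤-dense : ∀ k s → fromℕ k ≤ α * N → r ≤ fromℕ s → 2 ℕ.* (k ℕ.* e) ℕ.≤ n ℕ.* (s ℕ.+ e)
  ≤-dense k s k≤αn r≤s = fromℕ-cancel-≤ (begin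
    fromℕ (2 ℕ.* (k ℕ.* e))
      ∼⟨ ≤-reflexive (fromℕ (2 ℕ.* (k ℕ.* e))) (fromℕ (2 ℕ.* e) * fromℕ k) (λ _ → 2ke k) ⟩
    fromℕ (2 ℕ.* e) * fromℕ k      ∼⟨ *-monoʳ-≤ (2 ℕ.* e) (fromℕ k) (α * N) k≤αn ⟩
    fromℕ (2 ℕ.* e) * (α * N)
      ∼⟨ ≤-reflexive (fromℕ (2 ℕ.* e) * (α * N)) (N * (r′ + E)) (sym ∘ scaled-r′) ⟩
    N * (r′ + E)
      ∼⟨ *-monoʳ-≤ n (r′ + E) (fromℕ s + E)
           (+-monoˡ-≤ E r′ (fromℕ s) (≤-trans r′ r (fromℕ s) r′≤r r≤s)) ⟩
    N * (fromℕ s + E)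
      ∼⟨ ≤-reflexive (N * (fromℕ s + E)) (fromℕ (n ℕ.* (s ℕ.+ e))) (λ _ → sym (scaled-sum s)) ⟩
    fromℕ (n ℕ.* (s ℕ.+ e))        ∎)

  -- Multiplying α + c ≥ 1 by n² gives n² ≤ n (α n) + e. If n (k + 1) + e were at most n²,
  -- cancelling e and n would give k + 1 ≤ α n.
  n²<n[1+k]+e : 1ℝ ≤ α + c → ∀ k → ¬ fromℕ (suc k) ≤ α * N →
    n ℕ.* n ℕ.< n ℕ.* suc k ℕ.+ e
  n²<n[1+k]+e 1≤α+c k αn≱1+k = ℕₚ.≰⇒> λ le → αn≱1+k
    (*-cancelˡ-≤ n K (α * N) (+-cancelʳ-≤ E (N * K) (N * (α * N)) (begin
      N * K + E                     ∼⟨ ≤-reflexive (N * K + E) (fromℕ (n ℕ.* suc k ℕ.+ e))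
                                         (λ _ → sym (trans (ι-+ (n ℕ.* suc k) e)
                                           (cong (ℚ._+ ι e) (ι-* n (suc k))))) ⟩
      fromℕ (n ℕ.* suc k ℕ.+ e)     ∼⟨ fromℕ-mono-≤ le ⟩
      fromℕ (n ℕ.* n)
        ∼⟨ ≤-reflexive (fromℕ (n ℕ.* n)) (fromℕ (n ℕ.* n) * 1ℝ)
             (λ _ → sym (ℚₚ.*-identityʳ (ι (n ℕ.* n)))) ⟩
      fromℕ (n ℕ.* n) * 1ℝ          ∼⟨ *-monoʳ-≤ (n ℕ.* n) 1ℝ (α + c) 1≤α+c ⟩
      fromℕ (n ℕ.* n) * (α + c)
        ∼⟨ ≤-reflexive (fromℕ (n ℕ.* n) * (α + c)) (c * (N * N) + N * (α * N)) expand ⟩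
      c * (N * N) + N * (α * N)
        ∼⟨ +-monoˡ-≤ (N * (α * N)) (c * (N * N)) E
             (≃⇒≤ (c * (N * N)) E (≃-sym E (c * (N * N)) e≃cn²)) ⟩
      E + N * (α * N)
        ∼⟨ ≤-reflexive (E + N * (α * N)) (N * (α * N) + E) (λ i → ℚₚ.+-comm (ι e) (seq (N * (α * N)) i)) ⟩
      N * (α * N) + E               ∎)))
    where
    K = fromℕ (suc k)
    expand : ∀ i → seq (fromℕ (n ℕ.* n) * (α + c)) i ≡ seq (c * (N * N) + N * (α * N)) i
    expand i = trans (cong (ℚ._* seq (α + c) i) (ι-* n n))
      (solve 3 (λ n a c → n :* n :* (a :+ c) := c :* (n :* n) :+ n :* (a :* n)) refl
        (ι n) (seq α i) (seq c i))

k≤αn⇒k≤n : ∀ α n k → α ≤ 1ℝ → fromℕ k ≤ α * fromℕ n → k ℕ.≤ n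
k≤αn⇒k≤n α n k α≤1 k≤αn = fromℕ-cancel-≤ {k} {n} (begin
  fromℕ k       ∼⟨ k≤αn ⟩
  α * fromℕ n   ∼⟨ ≤-reflexive (α * fromℕ n) (fromℕ n * α) (λ i → ℚₚ.*-comm (seq α i) (ι n)) ⟩
  fromℕ n * α   ∼⟨ *-monoʳ-≤ n α 1ℝ α≤1 ⟩
  fromℕ n * 1ℝ  ∼⟨ ≤-reflexive (fromℕ n * 1ℝ) (fromℕ n) (λ _ → ℚₚ.*-identityʳ (ι n)) ⟩
  fromℕ n       ∎)
  where open ≤-Reasoning

n≤αn⇒1≤α : ∀ α n .{{_ : ℕ.NonZero n}} → fromℕ n ≤ α * fromℕ n → 1ℝ ≤ α
n≤αn⇒1≤α α n n≤αn = *-cancelˡ-≤ n 1ℝ α (begin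
  fromℕ n * 1ℝ  ∼⟨ ≤-reflexive (fromℕ n * 1ℝ) (fromℕ n) (λ _ → ℚₚ.*-identityʳ (ι n)) ⟩
  fromℕ n       ∼⟨ n≤αn ⟩
  α * fromℕ n   ∼⟨ ≤-reflexive (α * fromℕ n) (fromℕ n * α) (λ i → ℚₚ.*-comm (seq α i) (ι n)) ⟩
  fromℕ n * α   ∎)
  where open ≤-Reasoning

-- Sparse sets and regularity in terms of α and c.

open Combinatorics using (module Counting)

private
  r : ℝ → ℝ → ℕ → ℝ
  r α c n = (2ℝ * α - 1ℝ) * c * (fromℕ n * fromℕ n)

  r≡0 : ∀ α c i → seq (r α c 0) i ≡ 0ℚ
  r≡0 α c i = ℚₚ.*-zeroʳ (seq ((2ℝ * α - 1ℝ) * c) i)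

∃-sparse : ∀ α c → α ≤ 1ℝ → 1ℝ ≤ α + c → ∀ n (G : Graph n) → TriangleFree G →
  fromℕ (edgeCount G) ≃ c * (fromℕ n * fromℕ n) →
  ∀ k → ⌊ α * fromℕ n ⌋≡ k → ∃[ S ] (∣ S ∣ ≡ k × fromℕ (edgesSpanned G S) ≤ r α c n)
-- With no vertices one cannot divide by n, but then k = 0, and the empty set and the bound both
-- give 0.
∃-sparse α c α≤1 1≤α+c zero G tf e≃cn² k (k≤αn , _) =
  [] , sym (ℕₚ.n≤0⇒n≡0 (k≤αn⇒k≤n α 0 k α≤1 k≤αn)) , ≤-reflexive (fromℕ 0) (r α c 0) (sym ∘ r≡0 α c)
∃-sparse α c α≤1 1≤α+c n@(suc _) G tf e≃cn² k (k≤αn , αn<1+k) =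
  let S , ∣S∣≡k , sparse = Counting.∃-sparse G tf {k} (k≤αn⇒k≤n α n k α≤1 k≤αn) n²<
  in S , ∣S∣≡k , sparse-≤ α c n (edgeCount G) e≃cn² k (edgesSpanned G S) k≤αn sparse
  where
  n²< : n ℕ.* n ℕ.< n ℕ.* suc k ℕ.+ edgeCount G
  n²< = n²<n[1+k]+e α c n (edgeCount G) e≃cn² 1≤α+c k
    (<⇒≱ (α * fromℕ n) (fromℕ (suc k)) αn<1+k)

dense⇒regular : ∀ α c → 1ℝ ≤ α + c → ∀ n (G : Graph n) k → α * fromℕ n ≃ fromℕ k → TriangleFree G →
  fromℕ (edgeCount G) ≃ c * (fromℕ n * fromℕ n) → α < 1ℝ →
  (∀ S → ∣ S ∣ ≡ k → r α c n ≤ fromℕ (edgesSpanned G S)) → Regular G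
dense⇒regular α c 1≤α+c zero G k αn≃k tf e≃cn² α<1 dense ()
dense⇒regular α c 1≤α+c n@(suc _) G k αn≃k tf e≃cn² α<1 dense =
  Counting.dense⇒regular G tf {k} k<n n²< λ S ∣S∣≡k →
    ≤-dense α c n (edgeCount G) e≃cn² k (edgesSpanned G S) k≤αn (dense S ∣S∣≡k)
  where
  αn≤k = ≃⇒≤ (α * fromℕ n) (fromℕ k) αn≃k
  k≤αn = ≃⇒≤ (fromℕ k) (α * fromℕ n) (≃-sym (α * fromℕ n) (fromℕ k) αn≃k)

  -- From n ≤ k = α n it would follow that α ≥ 1; this is where α < 1 enters.
  k<n : k ℕ.< n
  k<n = ℕₚ.≰⇒> λ n≤k → <⇒≱ α 1ℝ α<1 (n≤αn⇒1≤α α n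
    (≤-trans (fromℕ n) (fromℕ k) (α * fromℕ n) (fromℕ-mono-≤ {n} {k} n≤k) k≤αn))

  -- As α n equals `k`, the inequality k + 1 ≤ α n would give k + 1 ≤ k.
  n²< : n ℕ.* n ℕ.< n ℕ.* suc k ℕ.+ edgeCount G
  n²< = n²<n[1+k]+e α c n (edgeCount G) e≃cn² 1≤α+c k λ 1+k≤αn →
    ℕₚ.1+n≰n (fromℕ-cancel-≤ {suc k} {k} (≤-trans (fromℕ (suc k)) (α * fromℕ n) (fromℕ k) 1+k≤αn αn≤k))

regular⇒dense : ∀ α c n (G : Graph n) k → α * fromℕ n ≃ fromℕ k →
  fromℕ (edgeCount G) ≃ c * (fromℕ n * fromℕ n) → Regular G →
  ∀ S → ∣ S ∣ ≡ k → r α c n ≤ fromℕ (edgesSpanned G S)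
regular⇒dense α c zero G k αn≃k e≃cn² regular [] _ = ≤-reflexive (r α c 0) (fromℕ 0) (r≡0 α c)
regular⇒dense α c n@(suc _) G k αn≃k e≃cn² regular S ∣S∣≡k =
  dense-≤ α c n (edgeCount G) e≃cn² k (edgesSpanned G S) (≃⇒≤ (α * fromℕ n) (fromℕ k) αn≃k)
    (subst (λ t → 2 ℕ.* (t ℕ.* edgeCount G) ℕ.≤ n ℕ.* (edgesSpanned G S ℕ.+ edgeCount G)) ∣S∣≡k
      (Counting.regular⇒dense G regular S))

theorem1p5 :
  (α c : ℝ) → 0ℝ ≤ α → α ≤ 1ℝ → 0ℝ ≤ c → c ≤ 1ℝ → 1ℝ ≤ α + c →
  -- (1)
  ((n : ℕ) (G : Graph n) → TriangleFree G →
    fromℕ (edgeCount G) ≃ c * (fromℕ n * fromℕ n) →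
    (k : ℕ) → ⌊ α * fromℕ n ⌋≡ k →
    ∃[ S ] (∣ S ∣ ≡ k ×
      fromℕ (edgesSpanned G S) ≤ (2ℝ * α - 1ℝ) * c * (fromℕ n * fromℕ n)))
  ×
  -- (2), with k the natural number α n.  Concluding that G is regular needs
  -- α < 1: for α = 1 the only vertex set of size n spans exactly c n² edges,
  -- whatever G is.
  ((n : ℕ) (G : Graph n) (k : ℕ) → α * fromℕ n ≃ fromℕ k → TriangleFree G →
    fromℕ (edgeCount G) ≃ c * (fromℕ n * fromℕ n) →
    (α < 1ℝ →
      ((S : Subset n) → ∣ S ∣ ≡ k →
        (2ℝ * α - 1ℝ) * c * (fromℕ n * fromℕ n) ≤ fromℕ (edgesSpanned G S)) →
      Regular G)
    ×
    (Regular G →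
      (S : Subset n) → ∣ S ∣ ≡ k →
        (2ℝ * α - 1ℝ) * c * (fromℕ n * fromℕ n) ≤ fromℕ (edgesSpanned G S)))
theorem1p5 α c _ α≤1 _ _ 1≤α+c =
  ∃-sparse α c α≤1 1≤α+c ,
  λ n G k αn≃k tf e≃cn² →
    dense⇒regular α c 1≤α+c n G k αn≃k tf e≃cn² ,
    regular⇒dense α c n G k αn≃k e≃cn²
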